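{- Let $C=C(\{C_s\}_{s\in S})\subseteq\Sigma^n$ be a lifted code such that all the codes $C_s$ have the same cardinality, and let $L\subseteq\prod_{s\in S}C_s$ be its line code. Let $\eta\in[0,\frac12\delta(L)]$ and suppose that $L$ has a decoding algorithm for words that are $\eta$-close to $L$. Then $C$ has a decoding algorithm for words that are $\frac{D_{\min}}{D_{\max}k_{\max}}\eta$-close to $C$. Provided that $k_{\max}=O(1)$ (as a function of $n$), its time complexity is $O(n+|S|)$ plus the time complexity of the decoding algorithm for $L$.
   Context: $\Sigma$ is a finite alphabet, $[n]=\{1,\dots,n\}$; $\mathrm{dist}$ denotes normalized Hamming distance (also on $\prod_{s\in S}C_s$, counting coordinates $s$). **Lifted code.** $S$ is a collection of subsets of $[n]$ with $\bigcup_{s\in S}s=[n]$ and $C_s\subseteq\Sigma^s$ is a nonempty code for each $s\in S$; $C(\{C_s\}_{s\in S})=\{g\in\Sigma^n:g|_s\in C_s\ \forall s\in S\}$. **Line code.** $L=\{(f_s)_{s\in S}\in\prod_{s\in S}C_s:f_s|_{s\cap s'}=f_{s'}|_{s\cap s'}\ \forall s,s'\in S\}$; identifying each $C_s$ with a fixed set $\Sigma'$, it is a code inside $\Sigma'^S$. **Distance, decoding.** $\delta(D)=\min\{\mathrm{dist}(f,g):f\ne g\in D\}$. $f$ is $\eta$-close to $D$ if $\mathrm{dist}(f,D)<\eta$; a decoding algorithm for words $\eta$-close to $D$ takes such $f$ and outputs the unique $f'\in D$ with $\mathrm{dist}(f,f')<\eta$. **Constants.** $k_{\max}=\max_{s\in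 S}|s|$, $D_{\min}=\min_{i\in[n]}\#\{s\in S:i\in s\}$, $D_{\max}=\max_{i\in[n]}\#\{s\in S:i\in s\}$. -}

module Defs where

open import Data.Bool using (if_then_else_; _∧_)
open import Data.Fin using (Fin; zero; suc; toℕ)
open import Data.Fin.Properties using () renaming (_≟_ to _≟ᶠ_)
open import Data.Fin.Subset using (Subset; inside; outside; _∈_; ∣_∣)
open import Data.Fin.Subset.Properties using (x∈p⇒∣p-x∣<∣p∣)
open import Data.Integer using (+_)
open import Data.Nat as ℕ using (ℕ; zero; suc; NonZero; _⊔_; _⊓_; _∸_; _≡ᵇ_; z≤n; s≤s)
import Data.Nat.Properties as ℕ
open import Data.Product using (∃; _×_; _,_; proj₁)
open import Data.Rational as ℚ using (ℚ; _/_; _<_; _≤_; _*_; 1/_; ½; Positive)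
import Data.Rational.Properties as ℚ
open import Data.Sum using (_⊎_; inj₁; inj₂)
open import Data.Vec using (Vec; []; _∷_; lookup; tabulate; count; zip; allFin; here; there)
open import Data.Vec.Properties using (lookup∘tabulate; []=⇒lookup; lookup⇒[]=)
open import Function using (_∘_; _⇔_; mk⇔; Equivalence)
open import Function.Definitions using (Injective)
open import Level using (0ℓ)
open import Relation.Binary.Definitions using (tri<; tri≈; tri>)
open import Relation.Binary.PropositionalEquality using (_≡_; refl; sym; trans; cong; subst)
open import Relation.Nullary using (¬_; ¬?)
open import Relation.Unary using (Pred)

------------------------------------------------------------------------
-- Real numbers: two-sided Dedekind cuts

record ℝ : Set₁ where
  field
    lower upper     : ℚ → Set
    lower-inhabited : ∃ lower
    upper-inhabited : ∃ upper
    lower-rounded   : ∀ q → lower q ⇔ ∃ λ r → q < r × lower r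
    upper-rounded   : ∀ q → upper q ⇔ ∃ λ r → r < q × upper r
    disjoint        : ∀ q → ¬ (lower q × upper q)
    located         : ∀ {q r} → q < r → lower q ⊎ upper r

infix 4 _<ʳ_ _≤ʳ_

_<ʳ_ : ℚ → ℝ → Set
q <ʳ x = ℝ.lower x q

_≤ʳ_ : ℝ → ℝ → Set
x ≤ʳ y = ∀ q → q <ʳ x → q <ʳ y

private
  q-1<q : ∀ q → q ℚ.- ℚ.1ℚ < q
  q-1<q q = subst (q ℚ.- ℚ.1ℚ <_) (ℚ.+-identityʳ q)
                  (ℚ.+-monoʳ-< q (ℚ.negative⁻¹ (ℚ.- ℚ.1ℚ)))

  q<q+1 : ∀ q → q < q ℚ.+ ℚ.1ℚ
  q<q+1 q = subst (_< q ℚ.+ ℚ.1ℚ) (ℚ.+-identityʳ q)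
                  (ℚ.+-monoʳ-< q (ℚ.positive⁻¹ ℚ.1ℚ))

fromℚ : ℚ → ℝ
fromℚ a = record
  { lower           = _< a
  ; upper           = a <_
  ; lower-inhabited = a ℚ.- ℚ.1ℚ , q-1<q a
  ; upper-inhabited = a ℚ.+ ℚ.1ℚ , q<q+1 a
  ; lower-rounded   = λ q → mk⇔ (λ q<a → ℚ.<-dense q<a)
                                (λ (r , q<r , r<a) → ℚ.<-trans q<r r<a)
  ; upper-rounded   = λ q → mk⇔ (λ a<q → let (r , a<r , r<q) = ℚ.<-dense a<q in r , r<q , a<r)
                                (λ (r , r<q , a<r) → ℚ.<-trans a<r r<q)
  ; disjoint        = λ q (q<a , a<q) → ℚ.<-asym q<a a<q
  ; located         = loc
  }
  where
  loc : ∀ {q r} → q < r → q < a ⊎ a < r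
  loc {q} q<r with ℚ.<-cmp q a
  ... | tri< q<a _ _ = inj₁ q<a
  ... | tri≈ _ q≡a _ = inj₂ (subst (_< _) q≡a q<r)
  ... | tri> _ _ a<q = inj₂ (ℚ.<-trans a<q q<r)

infixr 7 _·_

_·_ : (c : ℚ) .{{_ : Positive c}} → ℝ → ℝ
c · x = record
  { lower           = λ q → x.lower (c⁻¹ * q)
  ; upper           = λ q → x.upper (c⁻¹ * q)
  ; lower-inhabited = let (q , l) = x.lower-inhabited in c * q , subst x.lower (sym (cancel q)) l
  ; upper-inhabited = let (q , u) = x.upper-inhabited in c * q , subst x.upper (sym (cancel q)) u
  ; lower-rounded   = λ q → mk⇔
      (λ l → let (r , q<r , lr) = Equivalence.to (x.lower-rounded (c⁻¹ * q)) l in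
             c * r , subst (_< c * r) (cancel′ q) (ℚ.*-monoʳ-<-pos c q<r)
                   , subst x.lower (sym (cancel r)) lr)
      (λ (r , q<r , lr) → Equivalence.from (x.lower-rounded (c⁻¹ * q))
             (c⁻¹ * r , ℚ.*-monoʳ-<-pos c⁻¹ q<r , lr))
  ; upper-rounded   = λ q → mk⇔
      (λ u → let (r , r<q , ur) = Equivalence.to (x.upper-rounded (c⁻¹ * q)) u in
             c * r , subst (c * r <_) (cancel′ q) (ℚ.*-monoʳ-<-pos c r<q)
                   , subst x.upper (sym (cancel r)) ur)
      (λ (r , r<q , ur) → Equivalence.from (x.upper-rounded (c⁻¹ * q))
             (c⁻¹ * r , ℚ.*-monoʳ-<-pos c⁻¹ r<q , ur))
  ; disjoint        = λ q → x.disjoint (c⁻¹ * q)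
  ; located         = λ q<r → x.located (ℚ.*-monoʳ-<-pos c⁻¹ q<r)
  }
  where
  module x = ℝ x
  instance
    c≢0 : ℚ.NonZero c
    c≢0 = ℚ.pos⇒nonZero c
  c⁻¹ : ℚ
  c⁻¹ = 1/ c
  instance
    c⁻¹>0 : Positive c⁻¹
    c⁻¹>0 = ℚ.1/pos⇒pos c
  cancel : ∀ q → c⁻¹ * (c * q) ≡ q
  cancel q = trans (sym (ℚ.*-assoc c⁻¹ c q))
                   (trans (cong (_* q) (ℚ.*-inverseˡ c)) (ℚ.*-identityˡ q))
  cancel′ : ∀ q → c * (c⁻¹ * q) ≡ q
  cancel′ q = trans (sym (ℚ.*-assoc c c⁻¹ q))
                    (trans (cong (_* q) (ℚ.*-inverseʳ c)) (ℚ.*-identityˡ q))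

------------------------------------------------------------------------
-- Hamming distance, codes

Code : ℕ → ℕ → Set₁
Code q n = Pred (Vec (Fin q) n) 0ℓ

hamming : ∀ {q n} → Vec (Fin q) n → Vec (Fin q) n → ℕ
hamming f g = count (λ (a , b) → ¬? (a ≟ᶠ b)) (zip f g)

dist : ∀ {q n} .{{_ : NonZero n}} → Vec (Fin q) n → Vec (Fin q) n → ℚ
dist {n = n} f g = + hamming f g / n

IsMin : Pred ℚ 0ℓ → ℚ → Set
IsMin P d = P d × (∀ e → P e → d ≤ e)

module _ {q n : ℕ} .{{_ : NonZero n}} where

  -- d = dist(f,D).  For empty D there is no such d, i.e. dist(f,D) = ∞.
  IsDistTo : Vec (Fin q) n → Code q n → ℚ → Set
  IsDistTo f D = IsMin (λ e → ∃ λ g → D g × e ≡ dist f g)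

  -- d = δ(D).  If D has at most one element there is no such d, i.e. δ(D) = ∞.
  IsMinDist : Code q n → ℚ → Set
  IsMinDist D = IsMin (λ e → ∃ λ f → ∃ λ g → D f × D g × ¬ (f ≡ g) × e ≡ dist f g)

  infix 4 _≤½δ_

  _≤½δ_ : ℝ → Code q n → Set
  η ≤½δ D = ∀ d → IsMinDist D d → η ≤ʳ fromℚ (½ * d)

  Close : ℝ → Code q n → Vec (Fin q) n → Set
  Close η D f = ∃ λ d → IsDistTo f D d × d <ʳ η

------------------------------------------------------------------------
-- Words on a subset s of [n]: vectors of length ∣ s ∣, coordinates taken
-- in increasing order

restrict : ∀ {A : Set} {n} (s : Subset n) → Vec A n → Vec A ∣ s ∣
restrict []            []      = []
restrict (inside  ∷ s) (x ∷ g) = x ∷ restrict s g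
restrict (outside ∷ s) (x ∷ g) = restrict s g

-- The value at the point i of s.
at : ∀ {A : Set} {n} (s : Subset n) → Vec A ∣ s ∣ → {i : Fin n} → i ∈ s → A
at (inside  ∷ s) (x ∷ w) here      = x
at (inside  ∷ s) (x ∷ w) (there p) = at s w p
at (outside ∷ s) w       (there p) = at s w p

elements : ∀ {n} (s : Subset n) → Vec (Fin n) ∣ s ∣
elements s = restrict s (allFin _)

maxOver : ∀ {k} → (Fin k → ℕ) → ℕ
maxOver {zero}  f = 0
maxOver {suc k} f = f zero ⊔ maxOver (f ∘ suc)

minOver : ∀ {k} .{{_ : NonZero k}} → (Fin k → ℕ) → ℕ
minOver {suc zero}    f = f zero
minOver {suc (suc k)} f = f zero ⊓ minOver (f ∘ suc)

≤maxOver : ∀ {k} (f : Fin k → ℕ) i → f i ℕ.≤ maxOver f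
≤maxOver f zero    = ℕ.m≤m⊔n (f zero) _
≤maxOver f (suc i) = ℕ.≤-trans (≤maxOver (f ∘ suc) i) (ℕ.m≤n⊔m (f zero) _)

≤minOver : ∀ {k} .{{_ : NonZero k}} (f : Fin k → ℕ) {b} → (∀ i → b ℕ.≤ f i) → b ℕ.≤ minOver f
≤minOver {suc zero}    f h = h zero
≤minOver {suc (suc k)} f h = ℕ.⊓-glb (h zero) (≤minOver (f ∘ suc) (h ∘ suc))

any-index : ∀ n → .{{_ : NonZero n}} → Fin n
any-index (suc n) = zero

∈⇒1≤ : ∀ {n} {s : Subset n} {i} → i ∈ s → 1 ℕ.≤ ∣ s ∣
∈⇒1≤ p = ℕ.≤-trans (s≤s z≤n) (x∈p⇒∣p-x∣<∣p∣ p)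

record LiftedCode (q : ℕ) : Set₁ where
  field
    n          : ℕ
    {{n≢0}}    : NonZero n
    N          : ℕ                             -- the number of sets, |S|
    S          : Fin N → Subset n
    S-distinct : Injective _≡_ _≡_ S
    S-covers   : ∀ i → ∃ λ s → i ∈ S s
    C          : ∀ s → Code q ∣ S s ∣
    C-nonempty : ∀ s → ∃ (C s)

  lifted : Code q n
  lifted g = ∀ s → C s (restrict (S s) g)

  IsLine : (∀ s → Vec (Fin q) ∣ S s ∣) → Set
  IsLine f = (∀ s → C s (f s))
           × (∀ s s′ {i} (p : i ∈ S s) (p′ : i ∈ S s′) → at (S s) (f s) p ≡ at (S s′) (f s′) p′)

  degree : Fin n → ℕ
  degree i = ∣ tabulate (λ s → lookup (S s) i) ∣

  kmax Dmin Dmax : ℕ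
  kmax = maxOver (λ s → ∣ S s ∣)
  Dmin = minOver degree
  Dmax = maxOver degree

  private
    i₀ : Fin n
    i₀ = any-index n

    1≤degree : ∀ i → 1 ℕ.≤ degree i
    1≤degree i = let (s , p) = S-covers i in
      ∈⇒1≤ {s = tabulate (λ s → lookup (S s) i)} (lookup⇒[]= s _ (trans (lookup∘tabulate (λ s → lookup (S s) i) s) ([]=⇒lookup p)))

  instance
    N≢0 : NonZero N
    N≢0 = nonZero (proj₁ (S-covers i₀))
      where
      nonZero : ∀ {k} → Fin k → NonZero k
      nonZero zero    = _
      nonZero (suc _) = _

    kmax≢0 : NonZero kmax
    kmax≢0 = let (s , p) = S-covers i₀ in
      ℕ.>-nonZero (ℕ.≤-trans (∈⇒1≤ p) (≤maxOver (λ s → ∣ S s ∣) s))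

    Dmin≢0 : NonZero Dmin
    Dmin≢0 = ℕ.>-nonZero (≤minOver degree 1≤degree)

    Dmax≢0 : NonZero Dmax
    Dmax≢0 = ℕ.>-nonZero (ℕ.≤-trans (1≤degree i₀) (≤maxOver degree i₀))

    Dmax*kmax≢0 : NonZero (Dmax ℕ.* kmax)
    Dmax*kmax≢0 = ℕ.m*n≢0 Dmax kmax

  ratio : ℚ
  ratio = + Dmin / (Dmax ℕ.* kmax)

  instance
    ratio>0 : Positive ratio
    ratio>0 = ℚ.normalize-pos Dmin (Dmax ℕ.* kmax)

-- All codes C_s have the same cardinality m, witnessed by bijections of
-- Σ′ = Fin m with each C_s.
record Identification {q} (𝒞 : LiftedCode q) : Set where
  open LiftedCode 𝒞
  field
    m            : ℕ
    φ            : ∀ s → Fin m → Vec (Fin q) ∣ S s ∣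
    φ-codeword   : ∀ s a → C s (φ s a)
    φ-injective  : ∀ s → Injective _≡_ _≡_ (φ s)
    φ-surjective : ∀ s w → C s w → ∃ λ a → φ s a ≡ w

  line : Code m N
  line x = IsLine (λ s → φ s (lookup x s))

------------------------------------------------------------------------
-- Model of computation for "algorithm" and "time complexity": a random
-- access machine with named arrays of natural numbers, unit-cost addition and truncated subtraction
-- (and no multiplication), and read-only access to a description of the
-- lifted code.

record Description : Set where
  field
    #points #sets #symbols : ℕ                 -- n, |S|, |Σ′|
    size                   : ℕ → ℕ             -- s ↦ |s|
    element                : ℕ → ℕ → ℕ         -- s , l ↦ the l-th element of s
    symbol                 : ℕ → ℕ → ℕ → ℕ     -- s , a , l ↦ the l-th symbol of φ s a

data Expr : Set where
  lit                      : ℕ → Expr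
  `#points `#sets `#symbols : Expr
  `size                    : Expr → Expr
  `element                 : Expr → Expr → Expr
  `symbol                  : Expr → Expr → Expr → Expr
  _[_]                     : ℕ → Expr → Expr   -- a [ e ]: cell e of array a
  _`+_ _`∸_                : Expr → Expr → Expr

infixr 3 _⨾_
infix  4 _[_]≔_
infixl 6 _`+_ _`∸_

data Program : Set where
  skip          : Program
  _[_]≔_        : ℕ → Expr → Expr → Program
  _⨾_           : Program → Program → Program
  if≢0_then_else_ : Expr → Program → Program → Program
  while≢0_loop_   : Expr → Program → Program

Memory : Set
Memory = ℕ → ℕ → ℕ

write : Memory → ℕ → ℕ → ℕ → Memory
write μ a i v b j = if (a ≡ᵇ b) ∧ (i ≡ᵇ j) then v else μ b j

cost : Expr → ℕ
cost (lit k)            = 1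
cost `#points           = 1
cost `#sets             = 1
cost `#symbols          = 1
cost (`size e)          = suc (cost e)
cost (`element e e′)    = suc (cost e ℕ.+ cost e′)
cost (`symbol e e′ e″)  = suc (cost e ℕ.+ cost e′ ℕ.+ cost e″)
cost (a [ e ])          = suc (cost e)
cost (e `+ e′)          = suc (cost e ℕ.+ cost e′)
cost (e `∸ e′)          = suc (cost e ℕ.+ cost e′)

module _ (Δ : Description) where
  open Description Δ

  ⟦_⟧ : Expr → Memory → ℕ
  ⟦ lit k ⟧           μ = k
  ⟦ `#points ⟧        μ = #points
  ⟦ `#sets ⟧          μ = #sets
  ⟦ `#symbols ⟧       μ = #symbols
  ⟦ `size e ⟧         μ = size (⟦ e ⟧ μ)
  ⟦ `element e e′ ⟧   μ = element (⟦ e ⟧ μ) (⟦ e′ ⟧ μ)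
  ⟦ `symbol e e′ e″ ⟧ μ = symbol (⟦ e ⟧ μ) (⟦ e′ ⟧ μ) (⟦ e″ ⟧ μ)
  ⟦ a [ e ] ⟧         μ = μ a (⟦ e ⟧ μ)
  ⟦ e `+ e′ ⟧         μ = ⟦ e ⟧ μ ℕ.+ ⟦ e′ ⟧ μ
  ⟦ e `∸ e′ ⟧         μ = ⟦ e ⟧ μ ∸ ⟦ e′ ⟧ μ

  -- Run P μ t μ′: started in μ, the program P halts in μ′ after time t.
  data Run : Program → Memory → ℕ → Memory → Set where
    skip      : ∀ {μ} → Run skip μ 1 μ
    assign    : ∀ {a e e′ μ} →
                Run (a [ e ]≔ e′) μ (suc (cost e ℕ.+ cost e′)) (write μ a (⟦ e ⟧ μ) (⟦ e′ ⟧ μ))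
    seq       : ∀ {P Q μ μ′ μ″ t t′} →
                Run P μ t μ′ → Run Q μ′ t′ μ″ → Run (P ⨾ Q) μ (t ℕ.+ t′) μ″
    if-true   : ∀ {e P Q μ μ′ t} → ¬ (⟦ e ⟧ μ ≡ 0) →
                Run P μ t μ′ → Run (if≢0 e then P else Q) μ (suc (cost e ℕ.+ t)) μ′
    if-false  : ∀ {e P Q μ μ′ t} → ⟦ e ⟧ μ ≡ 0 →
                Run Q μ t μ′ → Run (if≢0 e then P else Q) μ (suc (cost e ℕ.+ t)) μ′
    while-end : ∀ {e P μ} → ⟦ e ⟧ μ ≡ 0 →
                Run (while≢0 e loop P) μ (suc (cost e)) μ
    while-step : ∀ {e P μ μ′ μ″ t t′} → ¬ (⟦ e ⟧ μ ≡ 0) →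
                Run P μ t μ′ → Run (while≢0 e loop P) μ′ t′ μ″ →
                Run (while≢0 e loop P) μ (suc (cost e ℕ.+ t ℕ.+ t′)) μ″

-- A finite table, continued by 0.
extend : ∀ {k} → (Fin k → ℕ) → ℕ → ℕ
extend {zero}  f i       = 0
extend {suc k} f zero    = f zero
extend {suc k} f (suc i) = extend (f ∘ suc) i

extend₂ : ∀ {k} {d : Fin k → ℕ} → (∀ s → Fin (d s) → ℕ) → ℕ → ℕ → ℕ
extend₂ f s j = extend (λ s → extend (f s) j) s

extend₃ : ∀ {k m} {d : Fin k → ℕ} → (∀ s → Fin m → Fin (d s) → ℕ) → ℕ → ℕ → ℕ → ℕ
extend₃ f s a j = extend (λ s → extend (λ a → extend (f s a) j) a) s

describe : ∀ {q} {𝒞 : LiftedCode q} → Identification 𝒞 → Description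
describe {𝒞 = 𝒞} ι = record
  { #points  = n
  ; #sets    = N
  ; #symbols = m
  ; size     = extend (λ s → ∣ S s ∣)
  ; element  = extend₂ (λ s l → toℕ (lookup (elements (S s)) l))
  ; symbol   = extend₃ (λ s a l → toℕ (lookup (φ s a) l))
  }
  where
  open LiftedCode 𝒞
  open Identification ι

-- The input word is stored in array 0; everything else is 0.
input : ∀ {q n} → Vec (Fin q) n → Memory
input f zero    = extend (toℕ ∘ lookup f)
input f (suc _) = λ _ → 0

-- The output word is read off array 1.
Outputs : ∀ {q n} → Memory → Vec (Fin q) n → Set
Outputs μ f = ∀ i → μ 1 (toℕ i) ≡ toℕ (lookup f i)

module _ {q n : ℕ} .{{_ : NonZero n}} (Δ : Description) where

  -- P is a decoding algorithm for words η-close to D; nothing is required of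
  -- P on other inputs.
  Decodes : Program → ℝ → Code q n → Set
  Decodes P η D = ∀ f → Close η D f →
    ∃ λ f′ → (D f′ × dist f f′ <ʳ η) ×
      (∀ g → D g → dist f g <ʳ η → g ≡ f′) ×
      (∃ λ t → ∃ λ μ → Run Δ P (input f) t μ × Outputs μ f′)

  -- Worst case over the words P is required to decode.
  RunsWithin : ℕ → Program → ℝ → Code q n → Set
  RunsWithin T P η D = ∀ f → Close η D f →
    ∃ λ t → ∃ λ μ → Run Δ P (input f) t μ × t ℕ.≤ T

{-# OPTIONS --safe #-}

-- Given f close to g ∈ C, let x_s be the symbol of f|_s when f|_s ∈ C_s and an
-- arbitrary one otherwise, and let y ∈ L be the line word of g.  A point where
-- f and g differ spoils at most Dmax sets, so hamming(x,y) ≤ Dmax · hamming(f,g);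
-- counting incidences, n · Dmin ≤ |S| · kmax.  Hence
-- dist(x,y) ≤ (Dmax kmax / Dmin) · dist(f,g) < η, the decoder of L maps x to y,
-- and g is read off y.  Both conversions take time linear in n + |S|: a set is
-- handled by comparing f|_s with all |Σ′| ≤ |Σ|^kmax codewords.

module Submission where

open import Defs
open import Data.Nat using (ℕ; _+_; _*_; _≤_)
open import Data.Product using (∃; _×_)
open import Data.Rational using (0ℚ)

open import Data.Bool using (Bool; true; false; T; if_then_else_; _∧_)
open import Data.Fin using (Fin; zero; suc; toℕ; fromℕ<; funToFin; finToFun)
open import Data.Fin.Properties
  using (toℕ-injective; toℕ<n; toℕ-fromℕ<; _≟_; any?; all?; injective⇒≤; finToFun-funToFin)
open import Data.Fin.Subset using (Subset; inside; outside; _∈_; ∣_∣)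
open import Data.Fin.Subset.Properties using (_∈?_)
import Data.Integer as ℤ
import Data.Integer.Properties as ℤ
open import Data.Nat using (zero; suc; _∸_; _^_; _<_; _≡ᵇ_; z≤n; s≤s; s≤s⁻¹; NonZero)
open import Data.Nat.Induction using (<-wellFounded)
open import Data.Nat.Properties hiding (_≟_)
import Data.Nat.Properties as ℕ
open import Data.Nat.Tactic.RingSolver using (solve-∀)
open import Data.Product using (_,_; proj₁; proj₂)
import Data.Rational as ℚ
open import Data.Rational using (ℚ)
import Data.Rational.Properties as ℚ
open import Data.Rational.Unnormalised as ℚᵘ using (*≤*)
import Data.Rational.Unnormalised.Properties as ℚᵘ
open import Data.Sum using (_⊎_; inj₁; inj₂)
open import Data.Vec as Vec using (Vec; []; _∷_; lookup; allFin; tabulate; here; there)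
open import Data.Vec.Properties
  using (lookup-map; lookup-allFin; map-lookup-allFin; lookup∘tabulate; tabulate∘lookup; tabulate-cong; ≡-dec)
open import Function using (_∘_; id; Equivalence)
open import Induction.WellFounded using (Acc; acc)
open import Relation.Binary.Definitions using (tri<; tri≈; tri>)
open import Relation.Binary.PropositionalEquality hiding ([_])
open import Relation.Nullary using (¬_; Dec; contradiction; yes; no; _×-dec_)
open import Relation.Nullary.Decidable using (map′)
open import Relation.Unary using (Decidable)
open import Algebra.Properties.Semiring.Sum +-*-semiring
  using (∑-comm; *-distribˡ-sum; *-distribʳ-sum; sum; sum-cong-≗)

-- `P′` is fixed before the code is: it is one program wrapped around `P` that takes n, |S|, |Σ′|
-- and all tables from the description, so that only the constant `A K` depends on the bound for
-- `kmax`. The description leads from symbols to words and not back, hence the exhaustive search.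
-- `P` is a black box, known only through its runs from `input x`, where everything outside array 0
-- is 0; so the encoding must remove its own traces, and runs must be carried over to the pointwise
-- equal memory that it leaves. Finally, `Decodes` applies only to words that are `Close`, which
-- asks for an attained minimum distance: a nearest line word has to be found, not merely one at
-- distance below η.

-- Timed program logic for the machine

infix 4 _≈_

_≈_ : Memory → Memory → Set
μ ≈ ν = ∀ a i → μ a i ≡ ν a i

write-cong : ∀ {μ ν} → μ ≈ ν → ∀ a i v → write μ a i v ≈ write ν a i v
write-cong μ≈ν a i v b j with (a ≡ᵇ b) ∧ (i ≡ᵇ j)
... | true  = refl
... | false = μ≈ν b j

var : ℕ → Expr
var v = v [ lit 0 ]

infix 4 _≔_

_≔_ : ℕ → Expr → Program
v ≔ e = v [ lit 0 ]≔ e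

-- Counting down makes the counter its own loop test and shows exactly the indices below the value
-- of `e` to a body that leaves `v` alone. The counter ends at 0, which spares a later clean-up.
for : ℕ → Expr → Program → Program
for v e P = v ≔ e ⨾ while≢0 var v loop (v ≔ var v `∸ lit 1 ⨾ P)

module Machine (Δ : Description) where
  open Description Δ

  eval-cong : ∀ {μ ν} e → μ ≈ ν → ⟦ Δ ⟧ e μ ≡ ⟦ Δ ⟧ e ν
  eval-cong (lit k)           μ≈ν = refl
  eval-cong `#points          μ≈ν = refl
  eval-cong `#sets            μ≈ν = refl
  eval-cong `#symbols         μ≈ν = refl
  eval-cong (`size e)         μ≈ν = cong size (eval-cong e μ≈ν)
  eval-cong (`element e e′)   μ≈ν = cong₂ element (eval-cong e μ≈ν) (eval-cong e′ μ≈ν)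
  eval-cong (`symbol e e′ e″) μ≈ν
    rewrite eval-cong e μ≈ν | eval-cong e′ μ≈ν | eval-cong e″ μ≈ν = refl
  eval-cong {ν = ν} (a [ e ]) μ≈ν = trans (μ≈ν a _) (cong (ν a) (eval-cong e μ≈ν))
  eval-cong (e `+ e′)         μ≈ν = cong₂ _+_ (eval-cong e μ≈ν) (eval-cong e′ μ≈ν)
  eval-cong (e `∸ e′)         μ≈ν = cong₂ _∸_ (eval-cong e μ≈ν) (eval-cong e′ μ≈ν)

  -- Expressions see a memory only through its cells, so pointwise equal memories take the same
  -- branches in the same time. This lets the run of `P` from `input x` start in the memory that the
  -- encoding actually leaves.
  run-cong : ∀ {P μ ν t μ′} → Run Δ P μ t μ′ → μ ≈ ν → ∃ λ ν′ → Run Δ P ν t ν′ × μ′ ≈ ν′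
  run-cong skip μ≈ν = _ , skip , μ≈ν
  run-cong {μ = μ} {ν} (assign {a} {e} {e′}) μ≈ν = _ , assign ,
    subst₂ (λ i v → write μ a (⟦ Δ ⟧ e μ) (⟦ Δ ⟧ e′ μ) ≈ write ν a i v)
           (eval-cong e μ≈ν) (eval-cong e′ μ≈ν) (write-cong μ≈ν a (⟦ Δ ⟧ e μ) (⟦ Δ ⟧ e′ μ))
  run-cong (seq r r′) μ≈ν =
    let (_ , s , p) = run-cong r μ≈ν ; (_ , s′ , p′) = run-cong r′ p in _ , seq s s′ , p′
  run-cong (if-true {e} e≢0 r) μ≈ν =
    let (_ , s , p) = run-cong r μ≈ν in
    _ , if-true (λ e≡0 → e≢0 (trans (eval-cong e μ≈ν) e≡0)) s , p
  run-cong (if-false {e} e≡0 r) μ≈ν =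
    let (_ , s , p) = run-cong r μ≈ν in
    _ , if-false (trans (sym (eval-cong e μ≈ν)) e≡0) s , p
  run-cong (while-end {e} e≡0) μ≈ν = _ , while-end (trans (sym (eval-cong e μ≈ν)) e≡0) , μ≈ν
  run-cong (while-step {e} e≢0 r r′) μ≈ν =
    let (_ , s , p) = run-cong r μ≈ν ; (_ , s′ , p′) = run-cong r′ p in
    _ , while-step (λ e≡0 → e≢0 (trans (eval-cong e μ≈ν) e≡0)) s s′ , p′

  -- `Decodes` and `RunsWithin` each supply a run of `P` of their own; since both end in the same
  -- memory, the timed one also has the right output.
  run-deterministic : ∀ {P μ t u μ′ μ″} → Run Δ P μ t μ′ → Run Δ P μ u μ″ → μ′ ≡ μ″
  run-deterministic skip skip = refl
  run-deterministic assign assign = refl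
  run-deterministic (seq r r′) (seq s s′) with run-deterministic r s
  ... | refl = run-deterministic r′ s′
  run-deterministic (if-true _ r) (if-true _ s) = run-deterministic r s
  run-deterministic (if-true e≢0 _) (if-false e≡0 _) = contradiction e≡0 e≢0
  run-deterministic (if-false e≡0 _) (if-true e≢0 _) = contradiction e≡0 e≢0
  run-deterministic (if-false _ r) (if-false _ s) = run-deterministic r s
  run-deterministic (while-end _) (while-end _) = refl
  run-deterministic (while-end e≡0) (while-step e≢0 _ _) = contradiction e≡0 e≢0
  run-deterministic (while-step e≢0 _ _) (while-end e≡0) = contradiction e≡0 e≢0
  run-deterministic (while-step _ r r′) (while-step _ s s′) with run-deterministic r s
  ... | refl = run-deterministic r′ s′

  -- Without function extensionality a postcondition can only be asked of some
  -- memory that is pointwise equal to the final one.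
  record Exec (P : Program) (μ : Memory) (Q : Memory → Set) (T : ℕ) : Set where
    constructor exec
    field
      {time}        : ℕ
      {final state} : Memory
      run           : Run Δ P μ time final
      time≤         : time ≤ T
      final≈state   : final ≈ state
      post          : Q state

  weaken : ∀ {P μ Q T T′} → T ≤ T′ → Exec P μ Q T → Exec P μ Q T′
  weaken T≤T′ (exec r t≤T p q) = exec r (≤-trans t≤T T≤T′) p q

  consequence : ∀ {P μ Q Q′ T} → (∀ {ν} → Q ν → Q′ ν) → Exec P μ Q T → Exec P μ Q′ T
  consequence Q⇒Q′ (exec r t≤T p q) = exec r t≤T p (Q⇒Q′ q)

  exec-cong : ∀ {P μ ν Q T} → μ ≈ ν → Exec P ν Q T → Exec P μ Q T
  exec-cong μ≈ν (exec r t≤T p q) =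
    let (_ , s , p′) = run-cong r (λ a i → sym (μ≈ν a i)) in
    exec s t≤T (λ a i → trans (sym (p′ a i)) (p a i)) q

  infixr 3 _⟫_

  _⟫_ : ∀ {P P′ μ Q R T T′} → Exec P μ Q T → (∀ {ν} → Q ν → Exec P′ ν R T′) →
           Exec (P ⨾ P′) μ R (T + T′)
  exec r t≤T p q ⟫ k with exec-cong p (k q)
  ... | exec r′ t′≤T′ p′ q′ = exec (seq r r′) (+-mono-≤ t≤T t′≤T′) p′ q′

  assigned : ∀ {μ ν} a e e′ → write μ a (⟦ Δ ⟧ e μ) (⟦ Δ ⟧ e′ μ) ≈ ν →
             Exec (a [ e ]≔ e′) μ (_≡ ν) (1 + (cost e + cost e′))
  assigned a e e′ p = exec assign ≤-refl p refl

  -- S k x is the memory in which the loop variable v has the value k and the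
  -- rest of the memory is described by x.
  module Loop (v : ℕ) {X : Set} (S : ℕ → X → Memory)
              (value  : ∀ k x → S k x v 0 ≡ k)
              (update : ∀ j k x → write (S k x) v 0 j ≈ S j x)
              (J : ℕ → X → Set) where

    At : ℕ → Memory → Set
    At k ν = ∃ λ x → J k x × ν ≡ S k x

    -- A round is indexed by `Fin N` so that the body can name the set, symbol or point it treats.
    -- The counter is already decremented when the body starts, while the invariant is still that of
    -- the previous value.
    Body : ℕ → Program → ℕ → Set
    Body N P T = ∀ (i : Fin N) x → J (suc (toℕ i)) x →
      Exec P (S (toℕ i) x) (λ ν → ∃ λ x′ → J (toℕ i) x′ × ν ≡ S (toℕ i) x′) T

    private
      body : ∀ {N P T} → Body N P T → ∀ (i : Fin N) {x} → J (suc (toℕ i)) x →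
             Exec (v ≔ var v `∸ lit 1 ⨾ P) (S (suc (toℕ i)) x) (At (toℕ i)) (6 + T)
      body B i {x} j =
        assigned v (lit 0) (var v `∸ lit 1)
          (subst (λ k → write (S (suc (toℕ i)) x) v 0 (k ∸ 1) ≈ S (toℕ i) x)
                 (sym (value _ x)) (update _ _ x))
        ⟫ λ { refl → B i x j }

      iterate : ∀ {N P T} → Body N P T → ∀ k → k ≤ N → ∀ {x} → J k x →
             Exec (while≢0 var v loop (v ≔ var v `∸ lit 1 ⨾ P)) (S k x) (At 0) (k * (9 + T) + 3)
      iterate B zero    _   {x} j = exec (while-end (value 0 x)) ≤-refl (λ _ _ → refl) (x , j , refl)
      iterate {P = P} {T} B (suc k) k<N {x} j
        with subst (λ k → ∀ {x} → J (suc k) x →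
                     Exec (v ≔ var v `∸ lit 1 ⨾ P) (S (suc k) x) (At k) (6 + T))
                   (toℕ-fromℕ< k<N) (body B (fromℕ< k<N)) j
      ... | exec r t≤ p (x′ , j′ , refl) with exec-cong p (iterate B k (<⇒≤ k<N) j′)
      ... | exec r′ t′≤ p′ q = exec (while-step (λ e≡0 → 1+n≢0 (trans (sym (value _ x)) e≡0)) r r′)
        (≤-trans (+-monoʳ-≤ 3 (+-mono-≤ t≤ t′≤))
                 (≤-reflexive (sym (+-assoc (9 + T) (k * (9 + T)) 3))))
        p′ q

    for-rule : ∀ {N P T} e {k x} → ⟦ Δ ⟧ e (S k x) ≡ N → J N x → Body N P T →
               Exec (for v e P) (S k x) (At 0) ((2 + cost e) + (N * (9 + T) + 3))
    for-rule e {k} {x} refl j B =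
      assigned v (lit 0) e (update _ k x) ⟫ λ { refl → iterate B _ ≤-refl j }

-- Tables, restrictions and array updates

extend-toℕ : ∀ {k} (f : Fin k → ℕ) i → extend f (toℕ i) ≡ f i
extend-toℕ f zero    = refl
extend-toℕ f (suc i) = extend-toℕ (f ∘ suc) i

extend-beyond : ∀ {k} (f : Fin k → ℕ) {j} → k ≤ j → extend f j ≡ 0
extend-beyond {zero}  f         _         = refl
extend-beyond {suc k} f {suc j} (s≤s k≤j) = extend-beyond (f ∘ suc) k≤j

restrict-map : ∀ {A B : Set} {n} (h : A → B) (s : Subset n) (v : Vec A n) →
               restrict s (Vec.map h v) ≡ Vec.map h (restrict s v)
restrict-map h []            []      = refl
restrict-map h (inside  ∷ s) (x ∷ v) = cong (h x ∷_) (restrict-map h s v)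
restrict-map h (outside ∷ s) (x ∷ v) = restrict-map h s v

lookup-restrict : ∀ {A : Set} {n} (s : Subset n) (v : Vec A n) l →
                  lookup (restrict s v) l ≡ lookup v (lookup (elements s) l)
lookup-restrict s v l = begin
  lookup (restrict s v) l                               ≡⟨ cong (λ w → lookup (restrict s w) l) (map-lookup-allFin v) ⟨
  lookup (restrict s (Vec.map (lookup v) (allFin _))) l ≡⟨ cong (λ w → lookup w l) (restrict-map (lookup v) s (allFin _)) ⟩
  lookup (Vec.map (lookup v) (elements s)) l            ≡⟨ lookup-map l (lookup v) (elements s) ⟩
  lookup v (lookup (elements s) l)                      ∎
  where open ≡-Reasoning

lookup-extensional : ∀ {A : Set} {n} {v w : Vec A n} → (∀ i → lookup v i ≡ lookup w i) → v ≡ w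
lookup-extensional {v = v} {w} h =
  trans (sym (tabulate∘lookup v)) (trans (tabulate-cong h) (tabulate∘lookup w))

elements-complete : ∀ {A : Set} {n} (s : Subset n) (v : Vec A n) {i} → i ∈ s →
                    ∃ λ l → lookup (restrict s v) l ≡ lookup v i
elements-complete (inside  ∷ s) (x ∷ v) here      = zero , refl
elements-complete (inside  ∷ s) (x ∷ v) (there p) = let (l , eq) = elements-complete s v p in suc l , eq
elements-complete (outside ∷ s) (x ∷ v) (there p) = elements-complete s v p

put : (ℕ → ℕ) → ℕ → ℕ → ℕ → ℕ
put A i v j = if i ≡ᵇ j then v else A j

put-same : ∀ A i v → put A i v i ≡ v
put-same A i v with i ≡ᵇ i in eq
... | true  = refl
... | false = contradiction (≡⇒≡ᵇ i i refl) (subst (λ b → ¬ T b) (sym eq) id)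

put-other : ∀ A i v {j} → j ≢ i → put A i v j ≡ A j
put-other A i v {j} j≢i with i ≡ᵇ j in eq
... | true  = contradiction (sym (≡ᵇ⇒≡ i j (subst T (sym eq) _))) j≢i
... | false = refl

-- Memory layout and the conversion programs

first : ℕ → (ℕ → ℕ) → ℕ → ℕ
first x r zero    = x
first x r (suc j) = r (suc j)

-- Arrays 0 and 1 hold words; cell 0 of arrays 2, 3, 4, 5 holds, respectively,
-- the current set, its symbol, the position in the set and a mismatch counter.
-- Everything else is taken from ρ.
mem : Memory → (A B : ℕ → ℕ) (s a l z : ℕ) → Memory
mem ρ A B s a l z 0 = A
mem ρ A B s a l z 1 = B
mem ρ A B s a l z 2 = first s (ρ 2)
mem ρ A B s a l z 3 = first a (ρ 3)
mem ρ A B s a l z 4 = first l (ρ 4)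
mem ρ A B s a l z 5 = first z (ρ 5)
mem ρ A B s a l z b@(suc (suc (suc (suc (suc (suc _)))))) = ρ b

module _ {ρ : Memory} {A B : ℕ → ℕ} {s a l z : ℕ} where

  write₀ : ∀ i {v} → write (mem ρ A B s a l z) 0 i v ≈ mem ρ (put A i v) B s a l z
  write₀ i 0 _ = refl
  write₀ i 1 _ = refl
  write₀ i 2 _ = refl
  write₀ i 3 _ = refl
  write₀ i 4 _ = refl
  write₀ i 5 _ = refl
  write₀ i (suc (suc (suc (suc (suc (suc _)))))) _ = refl

  write₁ : ∀ i {v} → write (mem ρ A B s a l z) 1 i v ≈ mem ρ A (put B i v) s a l z
  write₁ i 0 _ = refl
  write₁ i 1 _ = refl
  write₁ i 2 _ = refl
  write₁ i 3 _ = refl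
  write₁ i 4 _ = refl
  write₁ i 5 _ = refl
  write₁ i (suc (suc (suc (suc (suc (suc _)))))) _ = refl

  write₂ : ∀ {v} → write (mem ρ A B s a l z) 2 0 v ≈ mem ρ A B v a l z
  write₂ 0 _ = refl
  write₂ 1 _ = refl
  write₂ 2 zero = refl
  write₂ 2 (suc _) = refl
  write₂ 3 _ = refl
  write₂ 4 _ = refl
  write₂ 5 _ = refl
  write₂ (suc (suc (suc (suc (suc (suc _)))))) _ = refl

  write₃ : ∀ {v} → write (mem ρ A B s a l z) 3 0 v ≈ mem ρ A B s v l z
  write₃ 0 _ = refl
  write₃ 1 _ = refl
  write₃ 2 _ = refl
  write₃ 3 zero = refl
  write₃ 3 (suc _) = refl
  write₃ 4 _ = refl
  write₃ 5 _ = refl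
  write₃ (suc (suc (suc (suc (suc (suc _)))))) _ = refl

  write₄ : ∀ {v} → write (mem ρ A B s a l z) 4 0 v ≈ mem ρ A B s a v z
  write₄ 0 _ = refl
  write₄ 1 _ = refl
  write₄ 2 _ = refl
  write₄ 3 _ = refl
  write₄ 4 zero = refl
  write₄ 4 (suc _) = refl
  write₄ 5 _ = refl
  write₄ (suc (suc (suc (suc (suc (suc _)))))) _ = refl

  write₅ : ∀ {v} → write (mem ρ A B s a l z) 5 0 v ≈ mem ρ A B s a l v
  write₅ 0 _ = refl
  write₅ 1 _ = refl
  write₅ 2 _ = refl
  write₅ 3 _ = refl
  write₅ 4 _ = refl
  write₅ 5 zero = refl
  write₅ 5 (suc _) = refl
  write₅ (suc (suc (suc (suc (suc (suc _)))))) _ = refl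

-- Invariant of a loop that replaces f by g cell by cell; since counters descend, the finished cells
-- are the high ones. It speaks of all cells, also those beyond the table, so `split-start` wants f
-- and g to agree from n on, as tables continued by 0 do.
record Split (k : ℕ) (f g A : ℕ → ℕ) : Set where
  constructor split
  field
    below : ∀ {j} → j < k → A j ≡ f j
    above : ∀ {j} → k ≤ j → A j ≡ g j

split-start : ∀ {n f g A} → A ≗ f → (∀ {j} → n ≤ j → f j ≡ g j) → Split n f g A
split-start A≗f f≡g = split (λ _ → A≗f _) (λ n≤j → trans (A≗f _) (f≡g n≤j))

split-end : ∀ {f g A} → Split 0 f g A → A ≗ g
split-end sp _ = Split.above sp z≤n

split-step : ∀ {k f g A A′} → Split (suc k) f g A → (∀ {j} → j ≢ k → A′ j ≡ A j) → A′ k ≡ g k →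
             Split k f g A′
split-step {k} {f} {g} {A} {A′} (split below above) same new = split
  (λ j<k → trans (same (<⇒≢ j<k)) (below (m≤n⇒m≤1+n j<k))) high
  where
  high : ∀ {j} → k ≤ j → A′ j ≡ g j
  high {j} k≤j with j ℕ.≟ k
  ... | yes refl = new
  ... | no  j≢k  = trans (same j≢k) (above (≤∧≢⇒< k≤j (j≢k ∘ sym)))

split-put : ∀ {k f g A v} → Split (suc k) f g A → v ≡ g k → Split k f g (put A k v)
split-put {k} {A = A} {v} sp v≡gk =
  split-step sp (put-other A k v) (trans (put-same A k v) v≡gk)

-- Each round pays 3 for the loop test and 6 for the decrement on top of the body.
loopTime : ℕ → ℕ → ℕ
loopTime N T = N * (9 + T) + 3

-- The decoder for L reads array 0, writes array 1 and may rely on all other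
-- cells being 0: f is moved to array 1, x is built in array 0, then f is erased.
copyInput : Program
copyInput = for 2 `#points (1 [ var 2 ]≔ 0 [ var 2 ] ⨾ 0 [ var 2 ]≔ lit 0)

-- At most one of the two truncated differences is nonzero, so their sum is the absolute difference.
-- Accumulated over a set, it stays 0 exactly when all compared symbols agree.
expected actual discrepancy : Expr
expected    = `symbol (var 2) (var 3) (var 4)
actual      = 1 [ `element (var 2) (var 4) ]
discrepancy = (expected `∸ actual) `+ (actual `∸ expected)

-- Loops leave their counters at 0, so `clear` has only array 1 and the mismatch counter to reset.
-- `collect` assembles g in array 0 because later rounds still read the symbols of y in array 1;
-- hence the final copy in `publish`.
test search clear encode collect publish : Program
test    = 5 ≔ lit 0 ⨾ for 4 (`size (var 2)) (5 ≔ var 5 `+ discrepancy) ⨾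
          if≢0 var 5 then skip else (0 [ var 2 ]≔ var 3)
search  = for 2 `#sets (for 3 `#symbols test)
clear   = for 2 `#points (1 [ var 2 ]≔ lit 0) ⨾ 5 ≔ lit 0
encode  = copyInput ⨾ search ⨾ clear
collect = for 2 `#sets (for 4 (`size (var 2))
            (0 [ `element (var 2) (var 4) ]≔ `symbol (var 2) (1 [ var 2 ]) (var 4)))
publish = for 2 `#points (1 [ var 2 ]≔ 0 [ var 2 ])

-- Resetting the mismatch counter takes 3, starting the loop 5, and the costlier outcome of the
-- final branch, which writes a symbol, 8.
testTime : ℕ → ℕ
testTime K = 3 + ((5 + loopTime K (2 + cost (var 5 `+ discrepancy))) + 8)

-- Runs of the conversion programs

module Simulation {q : ℕ} (𝒞 : LiftedCode q) (ι : Identification 𝒞) where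
  open LiftedCode 𝒞
  open Identification ι

  Δ : Description
  Δ = describe ι

  open Machine Δ

  size-value : ∀ s → Description.size Δ (toℕ s) ≡ ∣ S s ∣
  size-value = extend-toℕ _

  element-value : ∀ s l → Description.element Δ (toℕ s) (toℕ l) ≡ toℕ (lookup (elements (S s)) l)
  element-value s l =
    trans (extend-toℕ (λ s → extend (λ l → toℕ (lookup (elements (S s)) l)) (toℕ l)) s)
          (extend-toℕ _ l)

  symbol-value : ∀ s a l →
    Description.symbol Δ (toℕ s) (toℕ a) (toℕ l) ≡ toℕ (lookup (φ s a) l)
  symbol-value s a l =
    trans (extend-toℕ (λ s → extend (λ a → extend (λ l → toℕ (lookup (φ s a) l)) (toℕ l)) (toℕ a)) s)
   (trans (extend-toℕ (λ a → extend (λ l → toℕ (lookup (φ s a) l)) (toℕ l)) a)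
          (extend-toℕ _ l))

  -- The words of L that the search may produce from f: where f|_s is not a
  -- codeword, coordinate s keeps the initial 0.
  record Reads (f : Vec (Fin q) n) (x : Vec (Fin m) N) : Set where
    constructor mkReads
    field
      letter : ∀ s → φ s (lookup x s) ≡ restrict (S s) f ⊎
        (∀ a → φ s a ≢ restrict (S s) f) × toℕ (lookup x s) ≡ 0

  record Spells (y : Vec (Fin m) N) (g : Vec (Fin q) n) : Set where
    constructor mkSpells
    field
      letter : ∀ s → φ s (lookup y s) ≡ restrict (S s) g

  module Encoding (f : Vec (Fin q) n) (x : Vec (Fin m) N) (reads : Reads f x) where

    f̂ x̂ : ℕ → ℕ
    f̂ = extend (toℕ ∘ lookup f)
    x̂ = extend (toℕ ∘ lookup x)

    private
      ρ : Memory
      ρ _ _ = 0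

    copyInput-exec : Exec copyInput (mem ρ f̂ (λ _ → 0) 0 0 0 0)
      (λ ν → ∃ λ ((A , B) : (ℕ → ℕ) × (ℕ → ℕ)) → (A ≗ (λ _ → 0) × B ≗ f̂) × ν ≡ mem ρ A B 0 0 0 0)
      (3 + loopTime n 10)
    copyInput-exec = consequence
      (λ ((A , B) , (spA , spB) , eq) → (A , B) , (split-end spA , split-end spB) , eq)
      (Loop.for-rule 2 (λ k (A , B) → mem ρ A B k 0 0 0) (λ _ _ → refl) (λ _ _ _ → write₂)
        (λ k (A , B) → Split k f̂ (λ _ → 0) A × Split k (λ _ → 0) f̂ B)
        `#points {x = f̂ , λ _ → 0} refl
        ( split-start (λ _ → refl) (extend-beyond _)
        , split-start (λ _ → refl) (sym ∘ extend-beyond _))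
        λ i (A , B) (spA , spB) →
          assigned 1 (var 2) (0 [ var 2 ]) (write₁ (toℕ i))
          ⟫ λ { refl → consequence
            -- Cell i lies below the split at i + 1, so array 0 still holds f there when it is
            -- copied.
            (λ { refl → _ , (split-put spA refl , split-put spB (Split.below spA ≤-refl)) , refl })
            (assigned 0 (var 2) (lit 0) (write₀ (toℕ i))) })

    module Row (B : ℕ → ℕ) (B≗f̂ : B ≗ f̂) (s : Fin N) where

      Agree : Fin m → ℕ → Set
      Agree a k = ∀ l → k ≤ toℕ l → lookup (φ s a) l ≡ lookup (restrict (S s) f) l

      actual-value : ∀ l → B (Description.element Δ (toℕ s) (toℕ l)) ≡ toℕ (lookup (restrict (S s) f) l)
      actual-value l = begin
        B (Description.element Δ (toℕ s) (toℕ l))     ≡⟨ cong B (element-value s l) ⟩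
        B (toℕ (lookup (elements (S s)) l))           ≡⟨ B≗f̂ _ ⟩
        f̂ (toℕ (lookup (elements (S s)) l))           ≡⟨ extend-toℕ _ (lookup (elements (S s)) l) ⟩
        toℕ (lookup f (lookup (elements (S s)) l))    ≡⟨ cong toℕ (lookup-restrict (S s) f l) ⟨
        toℕ (lookup (restrict (S s) f) l)             ∎
        where open ≡-Reasoning

      Verdict : Fin m → ℕ → ℕ → Set
      Verdict a k z = (z ≡ 0 → Agree a k) × (Agree a k → z ≡ 0)

      verdict-step : ∀ a (l : Fin ∣ S s ∣) {z x y} → x ≡ toℕ (lookup (φ s a) l) →
        y ≡ toℕ (lookup (restrict (S s) f) l) →
        Verdict a (suc (toℕ l)) z → Verdict a (toℕ l) (z + ((x ∸ y) + (y ∸ x)))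
      verdict-step a l {z} {x} {y} x≡ y≡ (sound , complete) = sound′ , complete′
        where
        sound′ : z + ((x ∸ y) + (y ∸ x)) ≡ 0 → Agree a (toℕ l)
        sound′ eq l′ l≤l′ with m≤n⇒m<n∨m≡n l≤l′
        ... | inj₁ l<l′ = sound (m+n≡0⇒m≡0 z eq) l′ l<l′
        ... | inj₂ l≡l′ with refl ← toℕ-injective l≡l′ =
          let d≡0 = m+n≡0⇒n≡0 z eq in
          toℕ-injective (trans (sym x≡) (trans
            (≤-antisym (m∸n≡0⇒m≤n (m+n≡0⇒m≡0 (x ∸ y) d≡0)) (m∸n≡0⇒m≤n (m+n≡0⇒n≡0 (x ∸ y) d≡0)))
            y≡))
        complete′ : Agree a (toℕ l) → z + ((x ∸ y) + (y ∸ x)) ≡ 0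
        complete′ agree
          rewrite complete (λ l′ l<l′ → agree l′ (<⇒≤ l<l′))
                | trans x≡ (trans (cong toℕ (agree l ≤-refl)) (sym y≡)) | n∸n≡0 y = refl

      Tested : (ℕ → ℕ) → Fin m → Memory → Set
      Tested A a ν = ∃ λ z →
        φ s a ≡ restrict (S s) f × ν ≡ mem ρ (put A (toℕ s) (toℕ a)) B (toℕ s) (toℕ a) 0 z ⊎
        φ s a ≢ restrict (S s) f × ν ≡ mem ρ A B (toℕ s) (toℕ a) 0 z

      compare-exec : ∀ A a →
        Exec (for 4 (`size (var 2)) (5 ≔ var 5 `+ discrepancy))
          (mem ρ A B (toℕ s) (toℕ a) 0 0)
          (λ ν → ∃ λ z → Verdict a 0 z × ν ≡ mem ρ A B (toℕ s) (toℕ a) 0 z)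
          (5 + loopTime ∣ S s ∣ (2 + cost (var 5 `+ discrepancy)))
      compare-exec A a =
        Loop.for-rule 4 (mem ρ A B (toℕ s) (toℕ a)) (λ _ _ → refl) (λ _ _ _ → write₄)
          (Verdict a) (`size (var 2)) (size-value s)
          ((λ _ l d≤l → contradiction d≤l (<⇒≱ (toℕ<n l))) , λ _ → refl)
          λ l z verdict → consequence
            (λ { refl → _ , verdict-step a l (symbol-value s a l) (actual-value l) verdict , refl })
            (assigned 5 (lit 0) (var 5 `+ discrepancy) write₅)

      test-exec : ∀ {K} → ∣ S s ∣ ≤ K → ∀ A a {z} →
        Exec test (mem ρ A B (toℕ s) (toℕ a) 0 z) (Tested A a) (testTime K)
      test-exec {K} d≤K A a = weaken
        (+-monoʳ-≤ 3 (+-monoˡ-≤ 8 (+-monoʳ-≤ 5 (+-monoˡ-≤ 3 (*-monoˡ-≤ (9 + (2 + cost (var 5 `+ discrepancy))) d≤K)))))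
        (assigned 5 (lit 0) (lit 0) write₅
          ⟫ λ { refl → compare-exec A a
          ⟫ λ { (z , verdict , refl) → branch z verdict } })
        where
        branch : ∀ z → Verdict a 0 z →
          Exec (if≢0 var 5 then skip else (0 [ var 2 ]≔ var 3))
               (mem ρ A B (toℕ s) (toℕ a) 0 z) (Tested A a) 8
        branch zero (sound , _) = exec (if-false refl assign) ≤-refl (write₀ (toℕ s))
          (0 , inj₁ (lookup-extensional (λ l → sound refl l z≤n) , refl))
        branch (suc z) (_ , complete) =
          exec (if-true 1+n≢0 skip) (m≤m+n 4 4) (λ _ _ → refl)
            (suc z , inj₂ ((λ eq → 1+n≢0 (complete λ l _ → cong (λ w → lookup w l) eq)) , refl))

      -- Symbols are tried from m - 1 downwards: either x_s has been written, or the cell is still 0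
      -- and x_s is among the untried symbols below k. At k = 0 nothing is untried, so the cell
      -- holds x_s.
      Found : (ℕ → ℕ) → ℕ → (ℕ → ℕ) → Set
      Found A k A′ = (∀ {j} → j ≢ toℕ s → A′ j ≡ A j) ×
        (A′ (toℕ s) ≡ toℕ (lookup x s) ⊎ A′ (toℕ s) ≡ 0 × toℕ (lookup x s) < k)

      found-hit : ∀ {A A′} (a : Fin m) → φ s a ≡ restrict (S s) f → Found A (suc (toℕ a)) A′ →
                  Found A (toℕ a) (put A′ (toℕ s) (toℕ a))
      found-hit {A′ = A′} a φa≡ (same , _) =
        (λ j≢s → trans (put-other A′ _ _ j≢s) (same j≢s)) ,
        inj₁ (trans (put-same A′ _ _) (cong toℕ a≡x))
        where
        a≡x : a ≡ lookup x s
        a≡x with Reads.letter reads s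
        ... | inj₁ φx≡      = φ-injective s (trans φa≡ (sym φx≡))
        ... | inj₂ (φ≢ , _) = contradiction φa≡ (φ≢ a)

      found-miss : ∀ {A A′} (a : Fin m) → φ s a ≢ restrict (S s) f → Found A (suc (toℕ a)) A′ →
                   Found A (toℕ a) A′
      found-miss a φa≢ (same , inj₁ A′≡x) = same , inj₁ A′≡x
      found-miss a φa≢ (same , inj₂ (A′≡0 , x≤a)) with m≤n⇒m<n∨m≡n (s≤s⁻¹ x≤a)
      ... | inj₁ x<a = same , inj₂ (A′≡0 , x<a)
      -- If the rejected symbol is x_s itself, then f|_s has no symbol at all, and x_s is the
      -- default 0 that the cell has held all along.
      ... | inj₂ x≡a with Reads.letter reads s
      ...   | inj₁ φx≡       = contradiction (trans (cong (φ s) (sym (toℕ-injective x≡a))) φx≡) φa≢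
      ...   | inj₂ (_ , x≡0) = same , inj₁ (trans A′≡0 (sym x≡0))

      row-exec : ∀ {K} → ∣ S s ∣ ≤ K → ∀ A → A (toℕ s) ≡ 0 → ∀ {z} →
        Exec (for 3 `#symbols test) (mem ρ A B (toℕ s) 0 0 z)
          (λ ν → ∃ λ ((A′ , z′) : (ℕ → ℕ) × ℕ) → Found A 0 A′ × ν ≡ mem ρ A′ B (toℕ s) 0 0 z′)
          (3 + loopTime m (testTime K))
      row-exec d≤K A A≡0 {z} =
        Loop.for-rule 3 (λ k (A , z) → mem ρ A B (toℕ s) k 0 z) (λ _ _ → refl) (λ _ _ _ → write₃)
          (λ k (A′ , _) → Found A k A′) `#symbols {x = A , z} refl
          ((λ _ → refl) , inj₂ (A≡0 , toℕ<n (lookup x s)))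
          λ a (A′ , _) found → consequence
            (λ { (_ , inj₁ (φa≡ , refl)) → _ , found-hit a φa≡ found , refl
               ; (_ , inj₂ (φa≢ , refl)) → _ , found-miss a φa≢ found , refl })
            (test-exec d≤K A′ a)

    search-exec : ∀ {K M} → (∀ s → ∣ S s ∣ ≤ K) → m ≤ M → ∀ {A B} → A ≗ (λ _ → 0) → B ≗ f̂ →
      Exec search (mem ρ A B 0 0 0 0)
        (λ ν → ∃ λ ((A′ , z) : (ℕ → ℕ) × ℕ) → A′ ≗ x̂ × ν ≡ mem ρ A′ B 0 0 0 z)
        (3 + loopTime N (3 + loopTime M (testTime K)))
    search-exec {K} {M} d≤K m≤M {A} {B} A≗0 B≗f̂ = consequence
      (λ (y , sp , eq) → y , split-end sp , eq)
      (Loop.for-rule 2 (λ k (A , z) → mem ρ A B k 0 0 z) (λ _ _ → refl) (λ _ _ _ → write₂)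
        (λ k (A , _) → Split k (λ _ → 0) x̂ A) `#sets {x = A , 0} refl
        (split-start A≗0 (sym ∘ extend-beyond _))
        λ s (A , z) sp → weaken (+-monoʳ-≤ 3 (+-monoˡ-≤ 3 (*-monoˡ-≤ (9 + testTime K) m≤M))) (consequence
          (λ { (y , (same , at-s) , refl) → y , split-step sp same (value s at-s) , refl })
          (Row.row-exec B B≗f̂ s (d≤K s) A (Split.below sp ≤-refl))))
      where
      value : ∀ s {v} → v ≡ toℕ (lookup x s) ⊎ v ≡ 0 × toℕ (lookup x s) < 0 → v ≡ x̂ (toℕ s)
      value s (inj₁ eq) = trans eq (sym (extend-toℕ _ s))

    clear-exec : ∀ {A B z} → A ≗ x̂ → B ≗ f̂ → Exec clear (mem ρ A B 0 0 0 z) (_≈ input x) (3 + loopTime n 4 + 3)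
    clear-exec {A} {B} {z} A≗x̂ B≗f̂ =
      Loop.for-rule 2 (λ k B → mem ρ A B k 0 0 z) (λ _ _ → refl) (λ _ _ _ → write₂)
        (λ k → Split k f̂ (λ _ → 0)) `#points {x = B} refl
        (split-start B≗f̂ (extend-beyond _))
        (λ i B sp → consequence (λ { refl → _ , split-put sp refl , refl })
          (assigned 1 (var 2) (lit 0) (write₁ (toℕ i))))
      ⟫ λ { (B , sp , refl) → consequence (λ { refl → cleared (split-end sp) })
              (assigned 5 (lit 0) (lit 0) write₅) }
      where
      cleared : ∀ {B} → B ≗ (λ _ → 0) → mem ρ A B 0 0 0 0 ≈ input x
      cleared B≗0 0 j       = A≗x̂ j
      cleared B≗0 1 j       = B≗0 j
      cleared B≗0 2 zero    = refl
      cleared B≗0 2 (suc _) = refl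
      cleared B≗0 3 zero    = refl
      cleared B≗0 3 (suc _) = refl
      cleared B≗0 4 zero    = refl
      cleared B≗0 4 (suc _) = refl
      cleared B≗0 5 zero    = refl
      cleared B≗0 5 (suc _) = refl
      cleared B≗0 (suc (suc (suc (suc (suc (suc _)))))) _ = refl

    encode-exec : ∀ {K M} → (∀ s → ∣ S s ∣ ≤ K) → m ≤ M → Exec encode (input f) (_≈ input x)
      ((3 + loopTime n 10) + ((3 + loopTime N (3 + loopTime M (testTime K))) + (3 + loopTime n 4 + 3)))
    encode-exec d≤K m≤M = exec-cong initial (copyInput-exec
      ⟫ λ { (_ , (A≗0 , B≗f̂) , refl) → search-exec d≤K m≤M A≗0 B≗f̂
      ⟫ λ { (_ , A≗x̂ , refl) → clear-exec A≗x̂ B≗f̂ } })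
      where
      initial : input f ≈ mem ρ f̂ (λ _ → 0) 0 0 0 0
      initial 0 j       = refl
      initial 1 j       = refl
      initial 2 zero    = refl
      initial 2 (suc _) = refl
      initial 3 zero    = refl
      initial 3 (suc _) = refl
      initial 4 zero    = refl
      initial 4 (suc _) = refl
      initial 5 zero    = refl
      initial 5 (suc _) = refl
      initial (suc (suc (suc (suc (suc (suc _)))))) _ = refl

  module Decoding (μ : Memory) (y : Vec (Fin m) N) (outputs : Outputs μ y)
                  (g : Vec (Fin q) n) (spells : Spells y g) where

    Correct : (ℕ → ℕ) → Fin n → Set
    Correct A i = A (toℕ i) ≡ toℕ (lookup g i)

    correct-new : ∀ A j {v} → v ≡ toℕ (lookup g j) → Correct (put A (toℕ j) v) j
    correct-new A j eq = trans (put-same A _ _) eq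

    -- A point is rewritten once for every set containing it. Each of these writes puts the symbol
    -- of g, so none can spoil a cell that is already correct.
    correct-put : ∀ {A i} j {v} → v ≡ toℕ (lookup g j) → Correct A i → Correct (put A (toℕ j) v) i
    correct-put {A} {i} j {v} eq correct with i ≟ j
    ... | yes refl = correct-new A i eq
    ... | no  i≢j  = trans (put-other A _ v (i≢j ∘ toℕ-injective)) correct

    Collected : ℕ → (ℕ → ℕ) → Set
    Collected k A = ∀ s l → k ≤ toℕ s → Correct A (lookup (elements (S s)) l)

    CollectedRow : Fin N → ℕ → (ℕ → ℕ) → Set
    CollectedRow s k A = Collected (suc (toℕ s)) A ×
      (∀ l → k ≤ toℕ l → Correct A (lookup (elements (S s)) l))

    collected-row : ∀ s A → CollectedRow s 0 A → Collected (toℕ s) A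
    collected-row s A (rest , row) s′ l s≤s′ with m≤n⇒m<n∨m≡n s≤s′
    ... | inj₁ s<s′ = rest s′ l s<s′
    ... | inj₂ s≡s′ with refl ← toℕ-injective s≡s′ = row l z≤n

    collected-step : ∀ s (l : Fin ∣ S s ∣) A {i v} → i ≡ toℕ (lookup (elements (S s)) l) →
      v ≡ toℕ (lookup g (lookup (elements (S s)) l)) →
      CollectedRow s (suc (toℕ l)) A → CollectedRow s (toℕ l) (put A i v)
    collected-step s l A {v = v} refl v≡ (rest , row) =
      (λ s′ l′ s<s′ → correct-put {A} (lookup (elements (S s)) l) v≡ (rest s′ l′ s<s′)) , row′
      where
      row′ : ∀ l′ → toℕ l ≤ toℕ l′ → Correct (put A (toℕ (lookup (elements (S s)) l)) v) (lookup (elements (S s)) l′)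
      row′ l′ l≤l′ with m≤n⇒m<n∨m≡n l≤l′
      ... | inj₁ l<l′ = correct-put {A} (lookup (elements (S s)) l) v≡ (row l′ l<l′)
      ... | inj₂ l≡l′ with refl ← toℕ-injective l≡l′ = correct-new A (lookup (elements (S s)) l) v≡

    collected⇒correct : ∀ A → Collected 0 A → ∀ i → Correct A i
    collected⇒correct A collected i =
      let (s , i∈s) = S-covers i
          (l , eq)  = elements-complete (S s) (allFin n) i∈s
      in subst (Correct A) (trans eq (lookup-allFin i)) (collected s l z≤n)

    spelled-value : ∀ s l →
      Description.symbol Δ (toℕ s) (μ 1 (toℕ s)) (toℕ l) ≡ toℕ (lookup g (lookup (elements (S s)) l))
    spelled-value s l = begin
      Description.symbol Δ (toℕ s) (μ 1 (toℕ s)) (toℕ l)          ≡⟨ cong (λ a → Description.symbol Δ (toℕ s) a (toℕ l)) (outputs s) ⟩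
      Description.symbol Δ (toℕ s) (toℕ (lookup y s)) (toℕ l)     ≡⟨ symbol-value s (lookup y s) l ⟩
      toℕ (lookup (φ s (lookup y s)) l)                           ≡⟨ cong (λ w → toℕ (lookup w l)) (Spells.letter spells s) ⟩
      toℕ (lookup (restrict (S s) g) l)                           ≡⟨ cong toℕ (lookup-restrict (S s) g l) ⟩
      toℕ (lookup g (lookup (elements (S s)) l))                  ∎
      where open ≡-Reasoning

    collect-exec : ∀ {K} → (∀ s → ∣ S s ∣ ≤ K) → ∀ {A s a l z} → Exec collect (mem μ A (μ 1) s a l z)
      (λ ν → ∃ λ ((A′ , l′) : (ℕ → ℕ) × ℕ) → Collected 0 A′ × ν ≡ mem μ A′ (μ 1) 0 a l′ z)
      (3 + loopTime N (5 + loopTime K 14))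
    collect-exec {K} d≤K {A} {_} {a} {l} {z} =
      Loop.for-rule 2 (λ k (A , l) → mem μ A (μ 1) k a l z) (λ _ _ → refl) (λ _ _ _ → write₂)
        (λ k (A , _) → Collected k A) `#sets {x = A , l} refl
        (λ s _ N≤s → contradiction N≤s (<⇒≱ (toℕ<n s)))
        -- 23 is the 9 that every round pays plus the 14 of the innermost assignment.
        λ s (A , l) collected → weaken (+-monoʳ-≤ 5 (+-monoˡ-≤ 3 (*-monoˡ-≤ 23 (d≤K s)))) (consequence
          (λ { (A′ , row , refl) → (A′ , 0) , collected-row s A′ row , refl })
          (Loop.for-rule 4 (λ k A → mem μ A (μ 1) (toℕ s) a k z) (λ _ _ → refl) (λ _ _ _ → write₄)
            (CollectedRow s) (`size (var 2)) {x = A} (size-value s)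
            (collected , λ l d≤l → contradiction d≤l (<⇒≱ (toℕ<n l)))
            λ l A row → consequence
              (λ { refl → _ , collected-step s l A (element-value s l) (spelled-value s l) row , refl })
              (assigned 0 (`element (var 2) (var 4)) (`symbol (var 2) (1 [ var 2 ]) (var 4))
                (write₀ (Description.element Δ (toℕ s) (toℕ l))))))

    publish-exec : ∀ {A B a l z} → (∀ i → Correct A i) →
      Exec publish (mem μ A B 0 a l z) (λ ν → Outputs ν g) (3 + loopTime n 6)
    publish-exec {A} {B} {a} {l} {z} correct = consequence
      (λ { (B , published , refl) i → published i z≤n })
      (Loop.for-rule 2 (λ k B → mem μ A B k a l z) (λ _ _ → refl) (λ _ _ _ → write₂)
        Published `#points {x = B} refl (λ i n≤i → contradiction n≤i (<⇒≱ (toℕ<n i)))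
        λ i B published → consequence (λ { refl → _ , published-step i B published , refl })
          (assigned 1 (var 2) (0 [ var 2 ]) (write₁ (toℕ i))))
      where
      Published : ℕ → (ℕ → ℕ) → Set
      Published k B = ∀ i → k ≤ toℕ i → Correct B i
      published-step : ∀ i B → Published (suc (toℕ i)) B →
                       Published (toℕ i) (put B (toℕ i) (A (toℕ i)))
      published-step i B published i′ i≤i′ with m≤n⇒m<n∨m≡n i≤i′
      ... | inj₁ i<i′ = correct-put {B} i (correct i) (published i′ i<i′)
      ... | inj₂ i≡i′ with refl ← toℕ-injective i≡i′ = correct-new B i (correct i)

    decode-exec : ∀ {K} → (∀ s → ∣ S s ∣ ≤ K) → Exec (collect ⨾ publish) μ (λ ν → Outputs ν g)
      ((3 + loopTime N (5 + loopTime K 14)) + (3 + loopTime n 6))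
    decode-exec d≤K = exec-cong self (collect-exec d≤K
      ⟫ λ { ((A , _) , collected , refl) → publish-exec (collected⇒correct A collected) })
      where
      self : μ ≈ mem μ (μ 0) (μ 1) (μ 2 0) (μ 3 0) (μ 4 0) (μ 5 0)
      self 0 j       = refl
      self 1 j       = refl
      self 2 zero    = refl
      self 2 (suc _) = refl
      self 3 zero    = refl
      self 3 (suc _) = refl
      self 4 zero    = refl
      self 4 (suc _) = refl
      self 5 zero    = refl
      self 5 (suc _) = refl
      self (suc (suc (suc (suc (suc (suc _)))))) _ = refl

-- Counting, finite search and rational bounds

∑-mono : ∀ {n} {f g : Fin n → ℕ} → (∀ i → f i ≤ g i) → sum f ≤ sum g
∑-mono {zero}  f≤g = z≤n
∑-mono {suc n} f≤g = +-mono-≤ (f≤g zero) (∑-mono (f≤g ∘ suc))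

∑-const : ∀ n c → sum {n} (λ _ → c) ≡ n * c
∑-const zero    c = refl
∑-const (suc n) c = cong (c +_) (∑-const n c)

indicator : Bool → ℕ
indicator b = if b then 1 else 0

∣∣≡∑ : ∀ {n} (s : Subset n) → ∣ s ∣ ≡ sum (λ i → indicator (lookup s i))
∣∣≡∑ []            = refl
∣∣≡∑ (inside  ∷ s) = cong suc (∣∣≡∑ s)
∣∣≡∑ (outside ∷ s) = ∣∣≡∑ s

differ : ∀ {q} → Fin q → Fin q → ℕ
differ a b with a ≟ b
... | yes _ = 0
... | no  _ = 1

hamming≡∑ : ∀ {q n} (f g : Vec (Fin q) n) → hamming f g ≡ sum (λ i → differ (lookup f i) (lookup g i))
hamming≡∑ []      []      = refl
hamming≡∑ (a ∷ f) (b ∷ g) with a ≟ b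
... | yes _ = hamming≡∑ f g
... | no  _ = cong suc (hamming≡∑ f g)

minOver≤ : ∀ {k} .{{_ : NonZero k}} (f : Fin k → ℕ) i → minOver f ≤ f i
minOver≤ {suc zero}    f zero    = ≤-refl
minOver≤ {suc (suc k)} f zero    = m⊓n≤m _ _
minOver≤ {suc (suc k)} f (suc i) = ≤-trans (m⊓n≤n (f zero) _) (minOver≤ (f ∘ suc) i)

at-restrict : ∀ {A : Set} {n} (s : Subset n) (g : Vec A n) {i} (p : i ∈ s) →
              at s (restrict s g) p ≡ lookup g i
at-restrict (inside  ∷ s) (x ∷ g) here      = refl
at-restrict (inside  ∷ s) (x ∷ g) (there p) = at-restrict s g p
at-restrict (outside ∷ s) (x ∷ g) (there p) = at-restrict s g p

-- The sum counts the points of s at which f and g differ; the bound charges a spoiled set to one of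
-- them.
restrict-differs : ∀ {q n} (s : Subset n) (f g : Vec (Fin q) n) → restrict s f ≢ restrict s g →
                   1 ≤ sum (λ i → differ (lookup f i) (lookup g i) * indicator (lookup s i))
restrict-differs []            []      []      ≢ = contradiction refl ≢
restrict-differs (outside ∷ s) (a ∷ f) (b ∷ g) ≢ = m≤n⇒m≤o+n _ (restrict-differs s f g ≢)
restrict-differs (inside  ∷ s) (a ∷ f) (b ∷ g) ≢ with a ≟ b
... | yes refl = restrict-differs s f g (≢ ∘ cong (a ∷_))
... | no  _    = s≤s z≤n

anyVec? : ∀ {m n} {P : Vec (Fin m) n → Set} → Decidable P → Dec (∃ P)
anyVec? {n = zero}  P? = map′ (λ p → [] , p) (λ { ([] , p) → p }) (P? [])
anyVec? {n = suc n} P? = map′ (λ (a , v , p) → a ∷ v , p) (λ { (a ∷ v , p) → a , v , p })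
                              (any? (λ a → anyVec? (P? ∘ (a ∷_))))

∈-irrelevant : ∀ {n} {s : Subset n} {i} (p p′ : i ∈ s) → p ≡ p′
∈-irrelevant here      here       = refl
∈-irrelevant (there p) (there p′) = cong there (∈-irrelevant p p′)

-- Membership proofs are unique, so a single instance decides the quantifier. `IsLine` quantifies
-- over such proofs.
all∈? : ∀ {n} {s : Subset n} {i} {P : i ∈ s → Set} → Decidable P → Dec (∀ p → P p)
all∈? {s = s} {i} {P} P? with i ∈? s
... | no  i∉s = yes (λ p → contradiction p i∉s)
... | yes p   = map′ (λ x p′ → subst P (∈-irrelevant p p′) x) (λ h → h p) (P? p)

argmin : ∀ {A : Set} {P : A → Set} (h : A → ℕ) → (∀ k → Dec (∃ λ y → P y × h y < k)) →
         ∀ x → P x → ∃ λ y → P y × (∀ z → P z → h y ≤ h z)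
argmin {A} {P} h smaller? x px = descend x px (<-wellFounded (h x))
  where
  descend : ∀ x → P x → Acc _<_ (h x) → ∃ λ y → P y × (∀ z → P z → h y ≤ h z)
  descend x px (acc rs) with smaller? (h x)
  ... | yes (y , py , y<x) = descend y py (rs y<x)
  ... | no  none           = x , px , λ z pz → ≮⇒≥ (λ z<x → none (z , pz , z<x))

-- `ℚ._/_` reduces fractions, so the comparison is carried out on unreduced ones, where it is
-- cross-multiplication.
/-mono-≤ : ∀ {a b n} .{{_ : NonZero n}} → a ≤ b → ℤ.+ a ℚ./ n ℚ.≤ ℤ.+ b ℚ./ n
/-mono-≤ {a} {b} {n@(suc _)} a≤b = ℚ.toℚᵘ-cancel-≤ (begin
  ℚ.toℚᵘ (ℤ.+ a ℚ./ n) ≃⟨ ℚ.toℚᵘ-fromℚᵘ (ℤ.+ a ℚᵘ./ n) ⟩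
  ℤ.+ a ℚᵘ./ n         ≤⟨ *≤* (ℤ.*-monoʳ-≤-nonNeg (ℤ.+ n) (ℤ.+≤+ a≤b)) ⟩
  ℤ.+ b ℚᵘ./ n         ≃⟨ ℚ.toℚᵘ-fromℚᵘ (ℤ.+ b ℚᵘ./ n) ⟨
  ℚ.toℚᵘ (ℤ.+ b ℚ./ n) ∎)
  where
  open ℚᵘ.≤-Reasoning

/*/≤/ : ∀ {a b c d e f} .{{_ : NonZero b}} .{{_ : NonZero d}} .{{_ : NonZero f}} →
        (a * c) * f ≤ e * (b * d) → (ℤ.+ a ℚ./ b) ℚ.* (ℤ.+ c ℚ./ d) ℚ.≤ ℤ.+ e ℚ./ f
/*/≤/ {a} {b@(suc _)} {c} {d@(suc _)} {e} {f@(suc _)} h = ℚ.toℚᵘ-cancel-≤ (begin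
  ℚ.toℚᵘ ((ℤ.+ a ℚ./ b) ℚ.* (ℤ.+ c ℚ./ d))          ≃⟨ ℚ.toℚᵘ-homo-* (ℤ.+ a ℚ./ b) (ℤ.+ c ℚ./ d) ⟩
  ℚ.toℚᵘ (ℤ.+ a ℚ./ b) ℚᵘ.* ℚ.toℚᵘ (ℤ.+ c ℚ./ d)    ≃⟨ ℚᵘ.*-cong (ℚ.toℚᵘ-fromℚᵘ (ℤ.+ a ℚᵘ./ b)) (ℚ.toℚᵘ-fromℚᵘ (ℤ.+ c ℚᵘ./ d)) ⟩
  (ℤ.+ a ℚᵘ./ b) ℚᵘ.* (ℤ.+ c ℚᵘ./ d)                ≤⟨ *≤* (subst₂ ℤ._≤_ lhs (ℤ.pos-* e (b * d)) (ℤ.+≤+ h)) ⟩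
  ℤ.+ e ℚᵘ./ f                                    ≃⟨ ℚ.toℚᵘ-fromℚᵘ (ℤ.+ e ℚᵘ./ f) ⟨
  ℚ.toℚᵘ (ℤ.+ e ℚ./ f)                            ∎)
  where
  open ℚᵘ.≤-Reasoning
  lhs : ℤ.+ ((a * c) * f) ≡ (ℤ.+ a ℤ.* ℤ.+ c) ℤ.* ℤ.+ f
  lhs = trans (ℤ.pos-* (a * c) f) (cong (ℤ._* ℤ.+ f) (ℤ.pos-* a c))

<ʳ-downward : ∀ (η : ℝ) {p r} → p ℚ.≤ r → r <ʳ η → p <ʳ η
<ʳ-downward η {p} {r} p≤r r<η with ℚ.<-cmp p r
... | tri< p<r _ _  = Equivalence.from (ℝ.lower-rounded η p) (r , p<r , r<η)
... | tri≈ _ refl _ = r<η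
... | tri> _ _ r<p  = contradiction (ℚ.<-≤-trans r<p p≤r) (ℚ.<-irrefl refl)

*≤⇒≤1/* : ∀ (c : ℚ) .{{c>0 : ℚ.Positive c}} {p r} → c ℚ.* p ℚ.≤ r →
          p ℚ.≤ (ℚ.1/ c) {{ℚ.pos⇒nonZero c}} ℚ.* r
*≤⇒≤1/* c {p} {r} cp≤r = ℚ.*-cancelˡ-≤-pos c (subst (c ℚ.* p ℚ.≤_) (sym cancel) cp≤r)
  where
  instance
    c≢0 : ℚ.NonZero c
    c≢0 = ℚ.pos⇒nonZero c
  cancel : c ℚ.* (ℚ.1/ c ℚ.* r) ≡ r
  cancel = trans (sym (ℚ.*-assoc c (ℚ.1/ c) r))
                 (trans (cong (ℚ._* r) (ℚ.*-inverseʳ c)) (ℚ.*-identityˡ r))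

-- K bounds kmax and M bounds |Σ′|.
encodeTime : (n N K M : ℕ) → ℕ
encodeTime n N K M = (3 + loopTime n 10) +
  ((3 + loopTime N (3 + loopTime M (testTime K))) + (3 + loopTime n 4 + 3))

decodeTime : (n N K : ℕ) → ℕ
decodeTime n N K = (3 + loopTime N (5 + loopTime K 14)) + (3 + loopTime n 6)

-- The three loops over points cost 19 + 13 + 15 = 47 per point and 33 is spent outside the rounds
-- of the outer loops; as n is at least 1, the points can bear both, whence 80. The base is `suc q`
-- because powers of 0 are not monotone in the exponent.
overhead : ℕ → ℕ → ℕ
overhead q K = 80 + (loopTime (suc q ^ K) (testTime K) + loopTime K 14)

-- Correctness and running time of the decoder for the lifted code

module _ {q : ℕ} (𝒞 : LiftedCode q) (ι : Identification 𝒞) where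
  open LiftedCode 𝒞
  open Identification ι
  open Simulation 𝒞 ι
  open Machine Δ

  spelling : ∀ g → lifted g → ∃ λ y → Spells y g
  spelling g lg = tabulate letter , mkSpells λ s →
    trans (cong (φ s) (lookup∘tabulate letter s)) (proj₂ (φ-surjective s _ (lg s)))
    where
    letter : Fin N → Fin m
    letter s = proj₁ (φ-surjective s (restrict (S s) g) (lg s))

  spells⇒line : ∀ {y g} → Spells y g → line y
  spells⇒line {y} {g} spells = (λ s → φ-codeword s _) , λ s s′ p p′ → trans (value s p) (sym (value s′ p′))
    where
    value : ∀ s {i} (p : i ∈ S s) → at (S s) (φ s (lookup y s)) p ≡ lookup g i
    value s p = trans (cong (λ w → at (S s) w p) (Spells.letter spells s)) (at-restrict (S s) g p)

  spells-injective : ∀ {y g g′} → Spells y g → Spells y g′ → g ≡ g′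
  spells-injective {y} {g} {g′} spells spells′ = lookup-extensional λ i →
    let (s , p) = S-covers i in begin
      lookup g i                    ≡⟨ at-restrict (S s) g p ⟨
      at (S s) (restrict (S s) g) p  ≡⟨ cong (λ w → at (S s) w p) (trans (sym (Spells.letter spells s)) (Spells.letter spells′ s)) ⟩
      at (S s) (restrict (S s) g′) p ≡⟨ at-restrict (S s) g′ p ⟩
      lookup g′ i                   ∎
    where open ≡-Reasoning

  line? : Decidable line
  line? y = map′ (λ h → (λ s → φ-codeword s _) , λ s s′ {i} → h s s′ i) (λ (_ , h) s s′ i → h s s′)
    (all? λ s → all? λ s′ → all? λ i → all∈? λ p → all∈? λ p′ →
      at (S s) (φ s (lookup y s)) p ≟ at (S s′) (φ s′ (lookup y s′)) p′)

  -- The line word y within η need not be nearest to x, as `Close` requires. Membership in `line` is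
  -- decidable and there are finitely many words, so descending from y ends at a minimiser, which is
  -- at most as far away.
  close : ∀ η x y → line y → dist x y <ʳ η → Close η line x
  close η x y ly x~y =
    let (y′ , ly′ , least) = argmin (hamming x) (λ k → anyVec? λ z → line? z ×-dec (hamming x z <? k)) y ly in
    dist x y′ , ((y′ , ly′ , refl) , λ { _ (z , lz , refl) → /-mono-≤ {n = N} (least z lz) }) ,
    <ʳ-downward η (/-mono-≤ {n = N} (least y ly)) x~y

  reading : ∀ f → ∃ λ x → Reads f x
  reading f = tabulate (proj₁ ∘ letter) , mkReads λ s →
    subst (λ a → φ s a ≡ restrict (S s) f ⊎ (∀ a → φ s a ≢ restrict (S s) f) × toℕ a ≡ 0)
          (sym (lookup∘tabulate (proj₁ ∘ letter) s)) (proj₂ (letter s))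
    where
    zeroth : ∀ {k} → Fin k → ∃ λ (a : Fin k) → toℕ a ≡ 0
    zeroth zero    = zero , refl
    zeroth (suc _) = zero , refl
    letter : ∀ s → ∃ λ a → φ s a ≡ restrict (S s) f ⊎ (∀ a → φ s a ≢ restrict (S s) f) × toℕ a ≡ 0
    letter s with any? (λ a → ≡-dec _≟_ (φ s a) (restrict (S s) f))
    ... | yes (a , eq) = a , inj₁ eq
    ... | no  none     =
      -- Nonemptiness of C_s makes Σ′ inhabited, so a symbol 0 exists. The default must be this one,
      -- being what the search leaves in an unmatched cell.
      let (w , cw) = C-nonempty s ; (a , a≡0) = zeroth (proj₁ (φ-surjective s w cw)) in
      a , inj₂ ((λ a eq → none (a , eq)) , a≡0)

  degree≡∑ : ∀ i → degree i ≡ sum (λ s → indicator (lookup (S s) i))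
  degree≡∑ i = trans (∣∣≡∑ (tabulate (λ s → lookup (S s) i)))
    (sum-cong-≗ (λ s → cong indicator (lookup∘tabulate (λ s → lookup (S s) i) s)))

  n*Dmin≤N*kmax : n * Dmin ≤ N * kmax
  n*Dmin≤N*kmax = begin
    n * Dmin                                                 ≡⟨ ∑-const n Dmin ⟨
    sum {n} (λ _ → Dmin)                                     ≤⟨ ∑-mono (minOver≤ degree) ⟩
    sum degree                                               ≡⟨ sum-cong-≗ degree≡∑ ⟩
    sum (λ i → sum (λ s → indicator (lookup (S s) i)))       ≡⟨ ∑-comm (λ i s → indicator (lookup (S s) i)) ⟩
    sum (λ s → sum (λ i → indicator (lookup (S s) i)))       ≡⟨ sum-cong-≗ (λ s → ∣∣≡∑ (S s)) ⟨
    sum (λ s → ∣ S s ∣)                                      ≤⟨ ∑-mono (≤maxOver (λ s → ∣ S s ∣)) ⟩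
    sum {N} (λ _ → kmax)                                     ≡⟨ ∑-const N kmax ⟩
    N * kmax                                                 ∎
    where open ≤-Reasoning

  module _ {f x} (reads : Reads f x) {y g} (spells : Spells y g) where

    hamming-reading : hamming x y ≤ hamming f g * Dmax
    hamming-reading = begin
      hamming x y                                                    ≡⟨ hamming≡∑ x y ⟩
      sum (λ s → differ (lookup x s) (lookup y s))                   ≤⟨ ∑-mono letter ⟩
      sum (λ s → sum (λ i → δ i * indicator (lookup (S s) i)))       ≡⟨ ∑-comm (λ s i → δ i * indicator (lookup (S s) i)) ⟩
      sum (λ i → sum (λ s → δ i * indicator (lookup (S s) i)))       ≡⟨ sum-cong-≗ (λ i → *-distribˡ-sum (δ i) (λ s → indicator (lookup (S s) i))) ⟨
      sum (λ i → δ i * sum (λ s → indicator (lookup (S s) i)))       ≡⟨ sum-cong-≗ (λ i → cong (δ i *_) (degree≡∑ i)) ⟨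
      sum (λ i → δ i * degree i)                                     ≤⟨ ∑-mono (λ i → *-monoʳ-≤ (δ i) (≤maxOver degree i)) ⟩
      sum (λ i → δ i * Dmax)                                         ≡⟨ *-distribʳ-sum Dmax δ ⟨
      sum δ * Dmax                                                   ≡⟨ cong (_* Dmax) (hamming≡∑ f g) ⟨
      hamming f g * Dmax                                             ∎
      where
      open ≤-Reasoning
      δ : Fin n → ℕ
      δ i = differ (lookup f i) (lookup g i)
      letter : ∀ s → differ (lookup x s) (lookup y s) ≤ sum (λ i → δ i * indicator (lookup (S s) i))
      letter s with lookup x s ≟ lookup y s
      ... | yes _   = z≤n
      -- If f and g agreed on s, then f|_s would be the codeword with symbol y_s; this excludes the
      -- default, and injectivity of φ gives x_s = y_s.
      ... | no  x≢y = restrict-differs (S s) f g λ f≡g → contradict f≡g (Reads.letter reads s)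
        where
        contradict : restrict (S s) f ≡ restrict (S s) g →
          ¬ (φ s (lookup x s) ≡ restrict (S s) f ⊎
             (∀ a → φ s a ≢ restrict (S s) f) × toℕ (lookup x s) ≡ 0)
        contradict f≡g (inj₁ φx≡)      = x≢y (φ-injective s (trans φx≡ (trans f≡g (sym (Spells.letter spells s)))))
        contradict f≡g (inj₂ (φ≢ , _)) = φ≢ (lookup y s) (trans (Spells.letter spells s) (sym f≡g))

    ratio*dist : ratio ℚ.* dist x y ℚ.≤ dist f g
    -- With denominators cleared, this is the product of the two counting bounds.
    ratio*dist = /*/≤/ {Dmin} {Dmax * kmax} {hamming x y} {N} {hamming f g} {n} (begin
      (Dmin * hamming x y) * n               ≡⟨ rearrangeˡ Dmin (hamming x y) n ⟩
      hamming x y * (n * Dmin)               ≤⟨ *-mono-≤ hamming-reading n*Dmin≤N*kmax ⟩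
      (hamming f g * Dmax) * (N * kmax)      ≡⟨ rearrangeʳ (hamming f g) Dmax N kmax ⟩
      hamming f g * ((Dmax * kmax) * N)      ∎)
      where
      open ≤-Reasoning
      rearrangeˡ : ∀ a b c → (a * b) * c ≡ b * (c * a)
      rearrangeˡ = solve-∀
      rearrangeʳ : ∀ a b c d → (a * b) * (c * d) ≡ a * ((b * d) * c)
      rearrangeʳ = solve-∀

    -- By the definition of `_·_`, a rational lies below `ratio · η` when its quotient by `ratio`
    -- lies below η, so the rational inequality is all that is needed.
    dist-reading : ∀ η → dist f g <ʳ ratio · η → dist x y <ʳ η
    dist-reading η = <ʳ-downward η (*≤⇒≤1/* ratio ratio*dist)

  -- `funToFin` numbers the words of length |s| by `Fin (q ^ ∣ S s ∣)`, and φ embeds Σ′ into these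
  -- words.
  m≤q^∣s∣ : ∀ s → m ≤ q ^ ∣ S s ∣
  m≤q^∣s∣ s = injective⇒≤ {f = λ a → funToFin (lookup (φ s a))} λ {a} {b} eq →
    φ-injective s (lookup-extensional λ l →
      trans (sym (finToFun-funToFin (lookup (φ s a)) l))
            (trans (cong (λ c → finToFun c l) eq) (finToFun-funToFin (lookup (φ s b)) l)))

  module _ {K : ℕ} (kmax≤K : kmax ≤ K) where

    ∣s∣≤K : ∀ s → ∣ S s ∣ ≤ K
    ∣s∣≤K s = ≤-trans (≤maxOver (λ s → ∣ S s ∣) s) kmax≤K

    m≤[1+q]^K : m ≤ suc q ^ K
    m≤[1+q]^K = let s = any-index N in begin
      m                ≤⟨ m≤q^∣s∣ s ⟩
      q ^ ∣ S s ∣      ≤⟨ ^-monoˡ-≤ ∣ S s ∣ (n≤1+n q) ⟩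
      suc q ^ ∣ S s ∣  ≤⟨ ^-monoʳ-≤ (suc q) (∣s∣≤K s) ⟩
      suc q ^ K        ∎
      where open ≤-Reasoning

    overhead-bound : ∀ t → encodeTime n N K (suc q ^ K) + (t + decodeTime n N K) ≤
                           overhead q K * (n + N) + t
    -- The inner loop times enter as variables U and V, which keeps the power of `suc q` out of the
    -- ring identity.
    overhead-bound t = bound n N t (loopTime (suc q ^ K) (testTime K)) (loopTime K 14)
      where
      -- n = 1 + k; the second summand is the slack.
      total : ∀ k N t U V →
        ((3 + (suc k * 19 + 3)) + ((3 + (N * (12 + U) + 3)) + (3 + (suc k * 13 + 3) + 3)) +
         (t + ((3 + (N * (14 + V) + 3)) + (3 + (suc k * 15 + 3))))) +
        (33 * k + 54 * N + (U + V) * suc k) ≡ (80 + (U + V)) * (suc k + N) + t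
      total = solve-∀
      bound : ∀ n .{{_ : NonZero n}} N t U V →
        ((3 + (n * 19 + 3)) + ((3 + (N * (12 + U) + 3)) + (3 + (n * 13 + 3) + 3)) +
         (t + ((3 + (N * (14 + V) + 3)) + (3 + (n * 15 + 3))))) ≤ (80 + (U + V)) * (n + N) + t
      bound (suc k) N t U V = ≤-trans (m≤m+n _ _) (≤-reflexive (total k N t U V))

    -- One given run is all that is known of `P`, so its exact final memory serves as postcondition
    -- and its exact time as bound.
    simulate : ∀ {P f x} y {g t μ} → Reads f x → Spells y g → Run Δ P (input x) t μ → Outputs μ y →
      Exec (encode ⨾ P ⨾ collect ⨾ publish) (input f) (λ ν → Outputs ν g) (overhead q K * (n + N) + t)
    simulate {P} {f} {x} y {g} {t} {μ} reads spells run outputs = weaken (overhead-bound t)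
      (Encoding.encode-exec f x reads ∣s∣≤K m≤[1+q]^K
        ⟫ λ ν≈ → exec-cong ν≈ inner
        ⟫ λ { refl → Decoding.decode-exec μ y outputs g spells ∣s∣≤K })
      where
      inner : Exec P (input x) (_≡ μ) t
      inner = exec run ≤-refl (λ _ _ → refl) refl

  module _ (P : Program) (η : ℝ) (decodes : Decodes Δ P η line) where

    record Decoded (f : Vec (Fin q) n) : Set where
      field
        word          : Vec (Fin q) n
        guess reply   : Vec (Fin m) N
        word∈         : lifted word
        word-close    : dist f word <ʳ ratio · η
        unique        : ∀ g → lifted g → dist f g <ʳ ratio · η → g ≡ word
        reads         : Reads f guess
        spells        : Spells reply word
        guess-close   : Close η line guess
        {time}        : ℕ
        {final}       : Memory
        run           : Run Δ P (input guess) time final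
        outputs       : Outputs final reply

    decoded : ∀ {f g x y} → lifted g → dist f g <ʳ ratio · η → Reads f x → Spells y g → Decoded f
    decoded {f} {g} {x} {y} lg f~g reads spells = answered (decodes x x-close)
      where
      x-close : Close η line x
      x-close = close η x y (spells⇒line spells) (dist-reading reads spells η f~g)
      answered : (∃ λ y′ → (line y′ × dist x y′ <ʳ η) × (∀ z → line z → dist x z <ʳ η → z ≡ y′) ×
        (∃ λ t → ∃ λ μ → Run Δ P (input x) t μ × Outputs μ y′)) → Decoded f
      answered (y′ , _ , unique , t , μ , run , outputs) = record
        { word = g ; guess = x ; reply = y ; word∈ = lg ; word-close = f~g
        ; reads = reads ; spells = spells ; guess-close = x-close
        ; unique = λ g′ lg′ f~g′ → unique′ g′ f~g′ (spelling g′ lg′)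
        ; run = run ; outputs = subst (Outputs μ) (sym (identify spells f~g)) outputs
        }
        where
        -- Every codeword within the radius of f has its line word within η of the same x, so that
        -- line word is the answer of `P`. This yields the output and, as a line word determines its
        -- codeword, uniqueness.
        identify : ∀ {z h} → Spells z h → dist f h <ʳ ratio · η → z ≡ y′
        identify {z} spells f~h = unique z (spells⇒line spells) (dist-reading reads spells η f~h)
        unique′ : ∀ g′ → dist f g′ <ʳ ratio · η → ∃ (λ z → Spells z g′) → g′ ≡ g
        unique′ g′ f~g′ (z , spells′) = spells-injective
          (subst (λ z → Spells z g′) (trans (identify spells′ f~g′) (sym (identify spells f~g))) spells′) spells

    decode-close : ∀ {f} → Close (ratio · η) lifted f → Decoded f
    decode-close {f} (_ , ((g , lg , refl) , _) , f~g) =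
      decoded lg f~g (proj₂ (reading f)) (proj₂ (spelling g lg))

    decodes-lifted : Decodes Δ (encode ⨾ P ⨾ collect ⨾ publish) (ratio · η) lifted
    decodes-lifted f f-close = run-of (decode-close f-close)
      where
      run-of : Decoded f → _
      run-of d = word , (word∈ , word-close) , unique ,
                 -- Only termination matters here, so K is taken to be `kmax` itself.
                 outcome (simulate ≤-refl reply reads spells run outputs)
        where
        open Decoded d
        outcome : ∀ {T} → Exec (encode ⨾ P ⨾ collect ⨾ publish) (input f) (λ ν → Outputs ν word) T → _
        outcome (exec {time} {final} run _ final≈ outputs) =
          time , final , run , λ i → trans (final≈ 1 (toℕ i)) (outputs i)

    runs-within : ∀ K T → kmax ≤ K → RunsWithin Δ T P η line →
      RunsWithin Δ (overhead q K * (n + N) + T) (encode ⨾ P ⨾ collect ⨾ publish) (ratio · η) lifted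
    runs-within K T kmax≤K within f f-close = bounded (decode-close f-close)
      where
      bounded : Decoded f → _
      bounded d = timed (within guess guess-close)
        where
        open Decoded d
        timed : (∃ λ t → ∃ λ μ → Run Δ P (input guess) t μ × t ≤ T) → _
        timed (t , μ , within-run , t≤T) =
          outcome (simulate kmax≤K reply reads spells within-run
            (subst (λ ν → Outputs ν reply) (run-deterministic run within-run) outputs))
          where
          outcome : Exec (encode ⨾ P ⨾ collect ⨾ publish) (input f) (λ ν → Outputs ν word)
                         (overhead q K * (n + N) + t) → _
          outcome (exec {time} {final} run′ time≤ _ _) =
            time , final , run′ , ≤-trans time≤ (+-monoʳ-≤ (overhead q K * (n + N)) t≤T)

proposition3p7 :
    ∀ (q : ℕ) →
    ∃ λ (A : ℕ → ℕ) →
    ∀ (P : Program) →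
    ∃ λ (P′ : Program) →
    ∀ (𝒞 : LiftedCode q) (ι : Identification 𝒞) (η : ℝ) →
    let open LiftedCode 𝒞
        open Identification ι
        Δ = describe ι
    in
    fromℚ 0ℚ ≤ʳ η →
    η ≤½δ line →
    Decodes Δ P η line →
    Decodes Δ P′ (ratio · η) lifted ×
    (∀ (K T : ℕ) → kmax ≤ K →
      RunsWithin Δ T P η line →
      RunsWithin Δ (A K * (n + N) + T) P′ (ratio · η) lifted)
proposition3p7 q = overhead q , λ P → (encode ⨾ P ⨾ collect ⨾ publish) , λ 𝒞 ι η _ _ decodes →
  decodes-lifted 𝒞 ι P η decodes , runs-within 𝒞 ι P η decodes
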